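{- No countable linear ordering has Scott sentence complexity $\Sigma^{\mathrm{in}}_3$; that is, there is no countable linear ordering which has a $\Sigma^{\mathrm{in}}_3$ Scott sentence but no Scott sentence that is $\Pi^{\mathrm{in}}_3$ or of lower complexity.
   Context: Infinitary formulas: $\Sigma^{\mathrm{in}}_0=\Pi^{\mathrm{in}}_0$ are the finitary quantifier-free formulas; for $\alpha\ge1$, a $\Sigma^{\mathrm{in}}_\alpha$ formula is a countable disjunction of formulas $\exists\bar x\,\varphi$ with $\varphi\in\Pi^{\mathrm{in}}_\beta$, $\beta<\alpha$, and $\Pi^{\mathrm{in}}_\alpha$ is dual. A $d\text{ - }\Sigma^{\mathrm{in}}_\alpha$ formula is a conjunction of a $\Sigma^{\mathrm{in}}_\alpha$ and a $\Pi^{\mathrm{in}}_\alpha$ formula. A Scott sentence of a countable structure is an $L_{\omega_1\omega}$ sentence whose countable models are exactly its isomorphic copies. The Scott sentence complexity $SSC(\mathcal{A})$ is the least class among $\Pi^{\mathrm{in}}_\alpha,\Sigma^{\mathrm{in}}_\alpha,d\text{ - }\Sigma^{\mathrm{in}}_\alpha$ ($\alpha\ge1$) in which $\mathcal{A}$ has a Scott sentence, classes ordered by inclusion up to equivalence ($\Pi_\alpha,\Sigma_\alpha\subseteq d\text{ - }\Sigma_\alpha\subseteq \Sigma_{\alpha+1}\cap\Pi_{\alpha+1}$). -}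

module Defs where

open import Data.Nat using (ℕ; zero; suc; _≤_)
open import Data.Fin using (Fin; zero; suc)
open import Data.Product using (Σ; Σ-syntax; _×_; _,_)
open import Data.Sum using (_⊎_)
open import Relation.Nullary using (¬_)
open import Relation.Binary using (IsStrictTotalOrder)
open import Relation.Binary.PropositionalEquality using (_≡_)
open import Function.Bundles using (_↔_; _⇔_; Inverse)
open import Function.Definitions using (Injective)

data Formula (n : ℕ) : Set where
  rel  : Fin n → Fin n → Formula n
  eq   : Fin n → Fin n → Formula n
  neg  : Formula n → Formula n
  _∧_  : Formula n → Formula n → Formula n
  _∨_  : Formula n → Formula n → Formula n
  ⋀    : (ℕ → Formula n) → Formula n
  ⋁    : (ℕ → Formula n) → Formula n
  ∃'   : Formula (suc n) → Formula n
  ∀'   : Formula (suc n) → Formula n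

Sentence : Set
Sentence = Formula 0

record Structure : Set₁ where
  field
    Carrier : Set
    _≺_     : Carrier → Carrier → Set
    enc     : Carrier → ℕ
    enc-inj : Injective _≡_ _≡_ enc

open Structure public

IsLinearOrdering : Structure → Set
IsLinearOrdering A = IsStrictTotalOrder _≡_ (_≺_ A)

extend : ∀ {n} {X : Set} → X → (Fin n → X) → Fin (suc n) → X
extend a ρ zero    = a
extend a ρ (suc i) = ρ i

Sat : ∀ {n} (A : Structure) → (Fin n → Carrier A) → Formula n → Set
Sat A ρ (rel i j) = _≺_ A (ρ i) (ρ j)
Sat A ρ (eq i j)  = ρ i ≡ ρ j
Sat A ρ (neg φ)   = ¬ Sat A ρ φ
Sat A ρ (φ ∧ ψ)   = Sat A ρ φ × Sat A ρ ψ
Sat A ρ (φ ∨ ψ)   = Sat A ρ φ ⊎ Sat A ρ ψ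
Sat A ρ (⋀ f)     = ∀ k → Sat A ρ (f k)
Sat A ρ (⋁ f)     = Σ ℕ λ k → Sat A ρ (f k)
Sat A ρ (∃' φ)    = Σ (Carrier A) λ a → Sat A (extend a ρ) φ
Sat A ρ (∀' φ)    = (a : Carrier A) → Sat A (extend a ρ) φ

emptyEnv : {X : Set} → Fin 0 → X
emptyEnv ()

_⊨_ : Structure → Sentence → Set
A ⊨ φ = Sat A emptyEnv φ

record _≅_ (A B : Structure) : Set where
  field
    iso  : Carrier A ↔ Carrier B
    pres : ∀ x y → _≺_ A x y ⇔ _≺_ B (Inverse.to iso x) (Inverse.to iso y)

IsScottSentence : Structure → Sentence → Set₁
IsScottSentence A φ = (B : Structure) → (B ⊨ φ) ⇔ (B ≅ A)

data QF {n : ℕ} : Formula n → Set where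
  qf-rel : ∀ i j → QF (rel i j)
  qf-eq  : ∀ i j → QF (eq i j)
  qf-neg : ∀ {φ} → QF φ → QF (neg φ)
  qf-∧   : ∀ {φ ψ} → QF φ → QF ψ → QF (φ ∧ ψ)
  qf-∨   : ∀ {φ ψ} → QF φ → QF ψ → QF (φ ∨ ψ)

mutual
  data Sig : ℕ → ∀ {n} → Formula n → Set where
    sig0 : ∀ {n} {φ : Formula n} → QF φ → Sig 0 φ
    sig⋁ : ∀ {m n} {f : ℕ → Formula n} → (∀ k → ExPi m (f k)) → Sig (suc m) (⋁ f)

  data Pi : ℕ → ∀ {n} → Formula n → Set where
    pi0 : ∀ {n} {φ : Formula n} → QF φ → Pi 0 φ
    pi⋀ : ∀ {m n} {f : ℕ → Formula n} → (∀ k → AllSig m (f k)) → Pi (suc m) (⋀ f)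

  data ExPi (m : ℕ) : ∀ {n} → Formula n → Set where
    ep-base : ∀ {b n} {ψ : Formula n} → b ≤ m → Pi b ψ → ExPi m ψ
    ep-∃    : ∀ {n} {ψ : Formula (suc n)} → ExPi m ψ → ExPi m (∃' ψ)

  data AllSig (m : ℕ) : ∀ {n} → Formula n → Set where
    as-base : ∀ {b n} {ψ : Formula n} → b ≤ m → Sig b ψ → AllSig m ψ
    as-∀    : ∀ {n} {ψ : Formula (suc n)} → AllSig m ψ → AllSig m (∀' ψ)

data DSig (m : ℕ) {n : ℕ} : Formula n → Set where
  dsig : ∀ {φ ψ} → Sig m φ → Pi m ψ → DSig m (φ ∧ ψ)

data Class : Set where
  Σc Πc dΣc : ℕ → Class

InClass : Class → ∀ {n} → Formula n → Set
InClass (Σc m)  φ = Sig m φ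
InClass (Πc m)  φ = Pi m φ
InClass (dΣc m) φ = DSig m φ

HasScottSentenceIn : Class → Structure → Set₁
HasScottSentenceIn c A = Σ[ φ ∈ Sentence ] (InClass c φ × IsScottSentence A φ)

SSC-is-Σ3 : Structure → Set₁
SSC-is-Σ3 A =
  HasScottSentenceIn (Σc 3) A
  × ¬ HasScottSentenceIn (Πc 3) A
  × (∀ m → 1 ≤ m → m ≤ 2 →
       ¬ HasScottSentenceIn (Σc m) A
     × ¬ HasScottSentenceIn (Πc m) A
     × ¬ HasScottSentenceIn (dΣc m) A)

{-# OPTIONS --safe #-}

-- A Σ₃ Scott sentence ∃x̄ θ(x̄) of A gives parameters ā with A ⊨ θ(ā), where θ is Π₂, and any two
-- linearly ordered models of θ (structures with parameters) are isomorphic.  Π₂ truth depends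
-- only on which finite configurations occur, so a gap between consecutive parameters that
-- contains arbitrarily long finite chains may be replaced by a copy of the rationals.  Hence A
-- is a finite sum of points and rational intervals; let k be the number of empty gaps.  Then
-- "there are points x̄ with the right gaps empty, and whenever these gaps of a tuple are empty,
-- its other gaps are dense" is a d-Σ₂ Scott sentence: a counterexample in A would yield k + 1
-- empty gaps.
--
-- The constructive difficulty is to find long chains in a gap that is merely not finite.  Build
-- a model that keeps the gap empty until an element of it turns up, and then makes an endpoint
-- of the gap trade places with that element.  The isomorphism with this model either exhibits
-- an element of the gap, or turns any such element into an automorphism moving the endpoint
-- into the gap, where its orbit is an infinite chain.
module Submission where

open import Defs
open import Data.Empty using (⊥; ⊥-elim; ⊥-elim-irr)
open import Data.Fin using (Fin; zero; suc; _↑ʳ_)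
open import Data.List.Base using (List; []; _∷_; _++_; map; concatMap; length; tabulate; upTo)
import Data.List.Membership.DecPropositional as DecMembership
open import Data.List.Membership.Propositional using (_∈_; mapWith∈; lose)
open import Data.List.Membership.Propositional.Properties
  using (∈-++⁺ˡ; ∈-++⁺ʳ; ∈-concatMap⁺; ∈-upTo⁺; ∈-map⁺; ∈-map⁻; ∈-tabulate⁺; ∈-tabulate⁻)
open import Data.List.Relation.Unary.All as All using (All; []; _∷_)
open import Data.List.Relation.Unary.All.Properties using (++⁻)
open import Data.List.Relation.Unary.Any using (Any; here; there; any?; satisfied)
open import Data.List.Relation.Unary.Any.Properties using (mapWith∈⁺)
open import Data.Nat as ℕ using (ℕ; zero; suc; z≤n; s≤s)
open import Data.Nat.Binary.Base using (ℕᵇ; zero; 2[1+_]; 1+[2_]; toℕ; fromℕ)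
open import Data.Nat.Binary.Properties
  using (toℕ-injective; fromℕ-injective; fromℕ-toℕ; 2[1+_]-injective; 1+[2_]-injective)
import Data.Nat.Properties as ℕ
open import Data.Product using (Σ-syntax; ∃; ∃-syntax; _×_; _,_; proj₁; proj₂; swap)
open import Data.Sum as Sum using (_⊎_; inj₁; inj₂)
open import Data.Unit using (⊤; tt)
open import Function.Base using (_∘_; id; _on_)
open import Function.Bundles using (_⇔_; mk⇔; mk↔ₛ′; Equivalence; Inverse)
open import Relation.Binary using (IsStrictTotalOrder; tri<; tri≈; tri>)
import Relation.Binary.Construct.Add.Extrema.Strict as Strict
import Relation.Binary.Construct.StrictToNonStrict as StrictToNonStrict
open import Relation.Binary.Definitions using (Tri)
open import Relation.Binary.PropositionalEquality
  using (_≡_; _≢_; refl; sym; trans; cong; subst; subst₂; isEquivalence)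
open import Relation.Binary.Structures.Biased using (isStrictTotalOrderᶜ)
open import Relation.Nullary using (¬_; Dec; yes; no; recompute)
open import Relation.Nullary.Construct.Add.Extrema using (_±; ⊥±; ⊤±; [_]; [_]-injective)
open import Relation.Unary using (Decidable)
open Equivalence using (to; from)

-- Linear orders

-- The goal is a negation, so finitely many case distinctions may be assumed. What fails
-- constructively is the passage from "for each m a chain of length m cannot fail to exist" to a
-- function producing all these chains, and `Densify` needs that function. An isomorphism, by
-- contrast, has values that can be inspected. The model it leads to is defined before anything is
-- known about the gap, so facts about that model hold only up to an escape type, through which a
-- proof reports a point of the gap.
--
-- Such an isomorphism is informative only if it sends the gap to its counterpart. What identifies a
-- gap is the number of empty gaps to its left. This number is an index of `Known`, and it forces
-- the gaps to be treated from left to right.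
--
-- A structure carries merely an injection into the naturals, along which one cannot search for a
-- point of a gap. The Skolem hull of the parameters is a union of finite stages that can be
-- searched.

module LinearOrder {X : Set} {_<_ : X → X → Set} (sto : IsStrictTotalOrder _≡_ _<_) where

  open IsStrictTotalOrder sto public
    using (compare; _<?_; _≟_; asym) renaming (trans to <-trans)
  open StrictToNonStrict _≡_ _<_ public using (_≤_)

  <-irr : ∀ {x} → ¬ (x < x)
  <-irr = IsStrictTotalOrder.irrefl sto refl

  ≤-refl : ∀ {x} → x ≤ x
  ≤-refl = inj₂ refl

  <-≤-trans : ∀ {x y z} → x < y → y ≤ z → x < z
  <-≤-trans x<y (inj₁ y<z)  = <-trans x<y y<z
  <-≤-trans x<y (inj₂ refl) = x<y

  ≤-<-trans : ∀ {x y z} → x ≤ y → y < z → x < z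
  ≤-<-trans (inj₁ x<y)  y<z = <-trans x<y y<z
  ≤-<-trans (inj₂ refl) y<z = y<z

  ≤-trans : ∀ {x y z} → x ≤ y → y ≤ z → x ≤ z
  ≤-trans (inj₁ x<y)  y≤z = inj₁ (<-≤-trans x<y y≤z)
  ≤-trans (inj₂ refl) y≤z = y≤z

  <⇒≱ : ∀ {x y} → x < y → ¬ (y ≤ x)
  <⇒≱ x<y y≤x = <-irr (<-≤-trans x<y y≤x)

  ≤-antisym : ∀ {x y} → x ≤ y → y ≤ x → x ≡ y
  ≤-antisym (inj₁ x<y)  y≤x = ⊥-elim (<⇒≱ x<y y≤x)
  ≤-antisym (inj₂ refl) _   = refl

  <-or-≥ : ∀ x y → x < y ⊎ y ≤ x
  <-or-≥ x y with compare x y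
  ... | tri< x<y _ _ = inj₁ x<y
  ... | tri≈ _ x≡y _ = inj₂ (inj₂ (sym x≡y))
  ... | tri> _ _ y<x = inj₂ (inj₁ y<x)

  ≮⇒≥ : ∀ {x y} → ¬ (x < y) → y ≤ x
  ≮⇒≥ {x} {y} x≮y with <-or-≥ x y
  ... | inj₁ x<y = ⊥-elim (x≮y x<y)
  ... | inj₂ y≤x = y≤x

  Between : X → X → X → Set
  Between x y z = x < z × z < y

  between? : ∀ x y z → Dec (Between x y z)
  between? x y z with x <? z | z <? y
  ... | yes p | yes q = yes (p , q)
  ... | no ¬p | _     = no (¬p ∘ proj₁)
  ... | _     | no ¬q = no (¬q ∘ proj₂)

  outside : ∀ {x y z} → ¬ Between x y z → z ≤ x ⊎ y ≤ z
  outside {x} {y} {z} z∉ with <-or-≥ x z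
  ... | inj₂ z≤x = inj₁ z≤x
  ... | inj₁ x<z = inj₂ (≮⇒≥ λ z<y → z∉ (x<z , z<y))

  -- k pairs x₁ < y₁ ≤ x₂ < y₂ ≤ … ≤ m.
  data Pairs : ℕ → X → Set where
    []   : ∀ {m} → Pairs 0 m
    snoc : ∀ {k x y m} → Pairs k x → x < y → y ≤ m → Pairs (suc k) m

  Hit : ∀ {k m} → Pairs k m → Set
  Hit []                        = ⊥
  Hit (snoc {x = x} {y} c _ _) = Hit c ⊎ ∃ (Between x y)

  weaken : ∀ {k m m'} → m ≤ m' → Pairs k m → Pairs k m'
  weaken _    []             = []
  weaken m≤m' (snoc c x<y y≤m) = snoc c x<y (≤-trans y≤m m≤m')

  Hit-weaken : ∀ {k m m'} (m≤m' : m ≤ m') (c : Pairs k m) → Hit (weaken m≤m' c) → Hit c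
  Hit-weaken _ (snoc c _ _) h = h

  -- The part below b decomposes into k empty gaps and finitely many dense ones.  P serves as
  -- an escape: everything is only claimed up to a proof of P.
  data Known (P : Set) : ℕ → X → Set where
    start : ∀ {b} → (∀ z → z < b → P) → Known P 0 b
    empty : ∀ {k l u} → Known P k l → l < u →
            (∀ z → Between l u z → P) → Known P (suc k) u
    -- The condition covers the closed interval: taking `x` to be `l` or `y` to be `u` shows that
    -- the gap has no first and no last point.
    dense : ∀ {k l u} → Known P k l → l < u →
            (∀ x y → l ≤ x → x < y → y ≤ u → P ⊎ ∃ (Between x y)) → Known P k u

  Mem : ∀ {P k b} → X → Known P k b → Set
  Mem e (start {b} _)       = e ≡ b
  Mem e (empty {u = u} K _ _) = Mem e K ⊎ e ≡ u
  Mem e (dense {u = u} K _ _) = Mem e K ⊎ e ≡ u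

  endpoint-Mem : ∀ {P k b} (K : Known P k b) → Mem b K
  endpoint-Mem (start _)     = refl
  endpoint-Mem (empty _ _ _) = inj₂ refl
  endpoint-Mem (dense _ _ _) = inj₂ refl

  Mem⇒≤ : ∀ {P k b e} (K : Known P k b) → Mem e K → e ≤ b
  Mem⇒≤ (start _)       refl        = ≤-refl
  Mem⇒≤ (empty K l<u _) (inj₁ e∈)   = ≤-trans (Mem⇒≤ K e∈) (inj₁ l<u)
  Mem⇒≤ (empty K l<u _) (inj₂ refl) = ≤-refl
  Mem⇒≤ (dense K l<u _) (inj₁ e∈)   = ≤-trans (Mem⇒≤ K e∈) (inj₁ l<u)
  Mem⇒≤ (dense K l<u _) (inj₂ refl) = ≤-refl

  -- Both lists are consumed from the right. An empty gap uses up at most one pair. A dense gap uses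
  -- up none: a pair inside it is hit by density, a pair straddling `l` is hit by `l`, and a pair to
  -- the left of `l` is passed on. One pair more than there are empty gaps is therefore hit
  -- somewhere.
  pigeonhole : ∀ {P k b} → Known P k b → (c : Pairs (suc k) b) → P ⊎ Hit c
  pigeonhole (start p) (snoc _ x<y y≤b) = inj₁ (p _ (<-≤-trans x<y y≤b))
  pigeonhole (empty {l = l} K l<u e) (snoc {x = x} c x<y y≤u) with <-or-≥ l x
  ... | inj₁ l<x = inj₁ (e _ (l<x , <-≤-trans x<y y≤u))
  ... | inj₂ x≤l = Sum.map₂ (inj₁ ∘ Hit-weaken x≤l c) (pigeonhole K (weaken x≤l c))
  pigeonhole (dense {l = l} K l<u d) (snoc {x = x} {y} c x<y y≤u) with <-or-≥ x l | <-or-≥ l y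
  ... | inj₂ l≤x | _        = Sum.map₂ inj₂ (d x y l≤x x<y y≤u)
  ... | inj₁ x<l | inj₁ l<y = inj₂ (inj₂ (l , x<l , l<y))
  ... | inj₁ x<l | inj₂ y≤l = pigeonhole K (snoc c x<y y≤l)

  -- The bound of `pigeonhole` is attained by the empty gaps themselves, so `k` is an invariant of
  -- the order below `b`.
  emptyPairs : ∀ {P k b} → Known P k b → Σ[ c ∈ Pairs k b ] (Hit c → P)
  emptyPairs (start _) = [] , λ ()
  emptyPairs (empty K l<u e) with emptyPairs K
  ... | c , none = snoc c l<u ≤-refl , λ { (inj₁ h) → none h ; (inj₂ (z , i)) → e z i }
  emptyPairs (dense K l<u _) with emptyPairs K
  ... | c , none = weaken (inj₁ l<u) c , none ∘ Hit-weaken (inj₁ l<u) c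

  data Chain : ℕ → X → X → Set where
    nil  : ∀ {l u} → l < u → Chain 0 l u
    cons : ∀ {n l u} x → l < x → Chain n x u → Chain (suc n) l u

  chain-< : ∀ {n l u} → Chain n l u → l < u
  chain-< (nil l<u)      = l<u
  chain-< (cons _ l<x c) = <-trans l<x (chain-< c)

  chain-snoc : ∀ {n l x u} → Chain n l x → x < u → Chain (suc n) l u
  chain-snoc (nil l<x)      x<u = cons _ l<x (nil x<u)
  chain-snoc (cons y l<y c) x<u = cons y l<y (chain-snoc c x<u)

  chain-lower : ∀ {n l l' u} → l' ≤ l → Chain n l u → Chain n l' u
  chain-lower l'≤l (nil l<u)      = nil (≤-<-trans l'≤l l<u)
  chain-lower l'≤l (cons x l<x c) = cons x (≤-<-trans l'≤l l<x) c

  chain-upper : ∀ {n l u u'} → u ≤ u' → Chain n l u → Chain n l u'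
  chain-upper u≤u' (nil l<u)      = nil (<-≤-trans l<u u≤u')
  chain-upper u≤u' (cons x l<x c) = cons x l<x (chain-upper u≤u' c)

-- Comparing the number of empty gaps along maps

module Transport
  {X Y : Set} {_<₁_ : X → X → Set} {_<₂_ : Y → Y → Set}
  (sto₁ : IsStrictTotalOrder _≡_ _<₁_) (sto₂ : IsStrictTotalOrder _≡_ _<₂_) where

  private
    module X = LinearOrder sto₁
    module Y = LinearOrder sto₂

  MonoBelow : X → (X → Y) → Set
  MonoBelow b f = ∀ {x y} → x <₁ y → y X.≤ b → f x <₂ f y

  OntoBelow : Set → X → (X → Y) → Set
  OntoBelow P b f = ∀ z → z <₂ f b → P ⊎ ∃[ x ] (x <₁ b × f x ≡ z)

  -- The danger lies in points of `Y` without a preimage: they might fall into an empty gap, or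
  -- bound a pair to which density in `X` says nothing. These points are charged to `P`.
  transport : ∀ {P k b} (f : X → Y) → MonoBelow b f → OntoBelow P b f →
              X.Known ⊥ k b → Y.Known P k (f b)
  transport {P} {k} {b} f mono onto = go
    where
    reflect : ∀ {x y} → x X.≤ b → y X.≤ b → f x <₂ f y → x <₁ y
    reflect {x} {y} x≤b y≤b fx<fy with X.<-or-≥ x y
    ... | inj₁ x<y         = x<y
    ... | inj₂ (inj₁ y<x)  = ⊥-elim (Y.asym fx<fy (mono y<x x≤b))
    ... | inj₂ (inj₂ refl) = ⊥-elim (Y.<-irr fx<fy)

    mono-≤ : ∀ {x y} → x X.≤ y → y X.≤ b → f x Y.≤ f y
    mono-≤ (inj₁ x<y)  y≤b = inj₁ (mono x<y y≤b)
    mono-≤ (inj₂ refl) _   = Y.≤-refl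

    mono-below : ∀ {l} → l X.≤ b → MonoBelow l f
    mono-below l≤b x<y y≤l = mono x<y (X.≤-trans y≤l l≤b)

    onto-below : ∀ {l} → l X.≤ b → OntoBelow P l f
    onto-below l≤b z z<fl with onto z (Y.<-≤-trans z<fl (mono-≤ l≤b X.≤-refl))
    ... | inj₁ p                 = inj₁ p
    ... | inj₂ (x , x<b , refl) = inj₂ (x , reflect (inj₁ x<b) l≤b z<fl , refl)

    onto-≤ : ∀ z → z Y.≤ f b → P ⊎ ∃[ x ] (x X.≤ b × f x ≡ z)
    onto-≤ z (inj₂ refl) = inj₂ (b , X.≤-refl , refl)
    onto-≤ z (inj₁ z<fb) = Sum.map₂ (λ (x , x<b , fx≡z) → x , inj₁ x<b , fx≡z) (onto z z<fb)

    go : X.Known ⊥ k b → Y.Known P k (f b)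
    go (X.start none) = Y.start λ z z<fb →
      Sum.[ id , (λ (x , x<b , _) → ⊥-elim (none x x<b)) ] (onto z z<fb)
    go (X.empty K l<u e) = Y.empty
      (transport f (mono-below (inj₁ l<u)) (onto-below (inj₁ l<u)) K)
      (mono l<u X.≤-refl)
      λ z (fl<z , z<fu) → Sum.[ id , (λ { (x , x<u , refl) →
        ⊥-elim (e x (reflect (inj₁ l<u) (inj₁ x<u) fl<z , x<u)) }) ] (onto z z<fu)
    go (X.dense {l = l} K l<u d) = Y.dense
      (transport f (mono-below (inj₁ l<u)) (onto-below (inj₁ l<u)) K)
      (mono l<u X.≤-refl)
      fill
      where
      reflect-≤ : ∀ {x y} → x X.≤ b → y X.≤ b → f x Y.≤ f y → x X.≤ y
      reflect-≤ x≤b y≤b fx≤fy = X.≮⇒≥ λ y<x → Y.<⇒≱ (mono y<x x≤b) fx≤fy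

      fill : ∀ x y → f l Y.≤ x → x <₂ y → y Y.≤ f b → P ⊎ ∃ (Y.Between x y)
      fill x y fl≤x x<y y≤fb with onto-≤ x (inj₁ (Y.<-≤-trans x<y y≤fb)) | onto-≤ y y≤fb
      ... | inj₁ p | _      = inj₁ p
      ... | _      | inj₁ p = inj₁ p
      ... | inj₂ (x' , x'≤b , refl) | inj₂ (y' , y'≤b , refl)
        with d x' y' (reflect-≤ (inj₁ l<u) x'≤b fl≤x) (reflect x'≤b y'≤b x<y) y'≤b
      ... | inj₂ (z , x'<z , z<y') =
        inj₂ (f z , mono x'<z (X.≤-trans (inj₁ z<y') y'≤b) , mono z<y' y'≤b)

  transport-Mem : ∀ {P k b} (f : X → Y) (mono : MonoBelow b f) (onto : OntoBelow P b f)
                  (K : X.Known ⊥ k b) {e} →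
                  X.Mem e K → Y.Mem (f e) (transport f mono onto K)
  transport-Mem f mono onto (X.start _)     refl        = refl
  transport-Mem f mono onto (X.empty K _ _) (inj₁ e∈)   = inj₁ (transport-Mem f _ _ K e∈)
  transport-Mem f mono onto (X.empty K _ _) (inj₂ refl) = inj₂ refl
  transport-Mem f mono onto (X.dense K _ _) (inj₁ e∈)   = inj₁ (transport-Mem f _ _ K e∈)
  transport-Mem f mono onto (X.dense K _ _) (inj₂ refl) = inj₂ refl

  private
    image : ∀ {k m} (h : X → Y) (h⁻¹ : Y → X) →
            (∀ {x y} → x <₁ y → h x <₂ h y) → (∀ {x y} → x <₂ y → h⁻¹ x <₁ h⁻¹ y) →
            (∀ x → h⁻¹ (h x) ≡ x) → (c : X.Pairs k m) →
            Σ[ c' ∈ Y.Pairs k (h m) ] (Y.Hit c' → X.Hit c)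
    image h h⁻¹ mono mono⁻¹ inv X.[] = Y.[] , λ ()
    image h h⁻¹ mono mono⁻¹ inv (X.snoc {x = x} {y} c x<y y≤m) with image h h⁻¹ mono mono⁻¹ inv c
    ... | c' , back = Y.snoc c' (mono x<y) (Sum.map mono (cong h) y≤m) , λ where
      (inj₁ hit) → inj₁ (back hit)
      (inj₂ (z , hx<z , z<hy)) → inj₂ (h⁻¹ z ,
        subst (_<₁ h⁻¹ z) (inv x) (mono⁻¹ hx<z) , subst (h⁻¹ z <₁_) (inv y) (mono⁻¹ z<hy))

  -- There are `suc k` pairs without a hit up to `u₁`, hence also up to `h u₁`, but `pigeonhole`
  -- allows only `k` of them up to `l₂`. So `h u₁` lies beyond `l₂`, and then beyond the empty gap
  -- that follows.
  gap-bound : ∀ {P k l₁ u₁ l₂ u₂} → X.Known P k l₁ → l₁ <₁ u₁ → (∀ z → X.Between l₁ u₁ z → P) →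
              Y.Known P k l₂ → (∀ z → Y.Between l₂ u₂ z → P) →
              (h : X → Y) (h⁻¹ : Y → X) →
              (∀ {x y} → x <₁ y → h x <₂ h y) → (∀ {x y} → x <₂ y → h⁻¹ x <₁ h⁻¹ y) →
              (∀ x → h⁻¹ (h x) ≡ x) → P ⊎ u₂ Y.≤ h u₁
  gap-bound {l₂ = l₂} {u₂} K₁ l₁<u₁ e₁ K₂ e₂ h h⁻¹ mono mono⁻¹ inv
    with image h h⁻¹ mono mono⁻¹ inv (X.snoc (proj₁ (X.emptyPairs K₁)) l₁<u₁ X.≤-refl)
  ... | c' , back with Y.<-or-≥ l₂ (h _)
  ... | inj₂ hu₁≤l₂ = inj₁ (Sum.[ id , none ∘ back ∘ Y.Hit-weaken hu₁≤l₂ c' ]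
                              (Y.pigeonhole K₂ (Y.weaken hu₁≤l₂ c')))
    where
    none : X.Hit (X.snoc (proj₁ (X.emptyPairs K₁)) l₁<u₁ X.≤-refl) → _
    none (inj₁ hit)     = proj₂ (X.emptyPairs K₁) hit
    none (inj₂ (z , i)) = e₁ z i
  ... | inj₁ l₂<hu₁ with Y.<-or-≥ (h _) u₂
  ... | inj₁ hu₁<u₂ = inj₁ (e₂ _ (l₂<hu₁ , hu₁<u₂))
  ... | inj₂ u₂≤hu₁ = inj₂ u₂≤hu₁

module Rigidity
  {X Y : Set} {_<₁_ : X → X → Set} {_<₂_ : Y → Y → Set}
  (sto₁ : IsStrictTotalOrder _≡_ _<₁_) (sto₂ : IsStrictTotalOrder _≡_ _<₂_) where

  private
    module X = LinearOrder sto₁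
    module Y = LinearOrder sto₂
    module XY = Transport sto₁ sto₂
    module YX = Transport sto₂ sto₁

  -- Isomorphisms preserve the number of empty gaps, hence fix the (k+1)-st one.
  gap-fixed : ∀ {P k l₁ u₁ l₂ u₂} →
    X.Known P k l₁ → l₁ <₁ u₁ → (∀ z → X.Between l₁ u₁ z → P) →
    Y.Known P k l₂ → l₂ <₂ u₂ → (∀ z → Y.Between l₂ u₂ z → P) →
    (h : X → Y) (h⁻¹ : Y → X) →
    (∀ {x y} → x <₁ y → h x <₂ h y) → (∀ {x y} → x <₂ y → h⁻¹ x <₁ h⁻¹ y) →
    (∀ x → h⁻¹ (h x) ≡ x) → (∀ y → h (h⁻¹ y) ≡ y) →
    P ⊎ (h l₁ ≡ l₂ × h u₁ ≡ u₂)
  gap-fixed {l₁ = l₁} {u₁} {l₂} {u₂} K₁ l₁<u₁ e₁ K₂ l₂<u₂ e₂ h h⁻¹ mono mono⁻¹ inv inv'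
    with XY.gap-bound K₁ l₁<u₁ e₁ K₂ e₂ h h⁻¹ mono mono⁻¹ inv
       | YX.gap-bound K₂ l₂<u₂ e₂ K₁ e₁ h⁻¹ h mono⁻¹ mono inv'
  ... | inj₁ p | _      = inj₁ p
  ... | _      | inj₁ p = inj₁ p
  ... | inj₂ u₂≤hu₁ | inj₂ u₁≤h⁻¹u₂ = lower
    where
    hu₁≡u₂ : h u₁ ≡ u₂
    hu₁≡u₂ = Y.≤-antisym (subst (h u₁ Y.≤_) (inv' u₂) (Sum.map mono (cong h) u₁≤h⁻¹u₂)) u₂≤hu₁

    h⁻¹u₂≡u₁ : h⁻¹ u₂ ≡ u₁
    h⁻¹u₂≡u₁ = trans (cong h⁻¹ (sym hu₁≡u₂)) (inv u₁)

    lower : _ ⊎ _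
    lower with Y.<-or-≥ l₂ (h l₁) | X.<-or-≥ l₁ (h⁻¹ l₂)
    ... | inj₁ l₂<hl₁ | _ = inj₁ (e₂ _ (l₂<hl₁ , subst (h l₁ <₂_) hu₁≡u₂ (mono l₁<u₁)))
    ... | _ | inj₁ l₁<h⁻¹l₂ = inj₁ (e₁ _ (l₁<h⁻¹l₂ , subst (h⁻¹ l₂ <₁_) h⁻¹u₂≡u₁ (mono⁻¹ l₂<u₂)))
    ... | inj₂ hl₁≤l₂ | inj₂ h⁻¹l₂≤l₁ = inj₂
      ( Y.≤-antisym hl₁≤l₂ (subst (Y._≤ h l₁) (inv' l₂) (Sum.map mono (cong h) h⁻¹l₂≤l₁))
      , hu₁≡u₂ )

-- Satisfaction

module Iso {A B : Structure} (h : A ≅ B) where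
  open _≅_ h public using (iso; pres)
  open Inverse iso public using (strictlyInverseˡ; strictlyInverseʳ)

  fwd : Carrier A → Carrier B
  fwd = Inverse.to iso

  bwd : Carrier B → Carrier A
  bwd = Inverse.from iso

  fwd-mono : ∀ {x y} → _≺_ A x y → _≺_ B (fwd x) (fwd y)
  fwd-mono = to (pres _ _)

  bwd-mono : ∀ {x y} → _≺_ B x y → _≺_ A (bwd x) (bwd y)
  bwd-mono {x} {y} x≺y = from (pres _ _)
    (subst₂ (_≺_ B) (sym (strictlyInverseˡ x)) (sym (strictlyInverseˡ y)) x≺y)

  fwd-injective : ∀ {x y} → fwd x ≡ fwd y → x ≡ y
  fwd-injective {x} {y} e =
    trans (sym (strictlyInverseʳ x)) (trans (cong bwd e) (strictlyInverseʳ y))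

≅-refl : ∀ {A} → A ≅ A
≅-refl = record
  { iso = mk↔ₛ′ id id (λ _ → refl) (λ _ → refl) ; pres = λ _ _ → mk⇔ id id }

≅-sym : ∀ {A B} → A ≅ B → B ≅ A
≅-sym {A} {B} h = record
  { iso  = mk↔ₛ′ bwd fwd strictlyInverseʳ strictlyInverseˡ
  ; pres = λ x y → mk⇔ bwd-mono λ lt →
      subst₂ (_≺_ B) (strictlyInverseˡ x) (strictlyInverseˡ y) (fwd-mono lt) }
  where open Iso h

≅-trans : ∀ {A B C} → A ≅ B → B ≅ C → A ≅ C
≅-trans {A} {B} {C} g h = record
  { iso  = mk↔ₛ′ (H.fwd ∘ G.fwd) (G.bwd ∘ H.bwd)
             (λ z → trans (cong H.fwd (G.strictlyInverseˡ _)) (H.strictlyInverseˡ z))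
             (λ x → trans (cong G.bwd (H.strictlyInverseʳ _)) (G.strictlyInverseʳ x))
  ; pres = λ x y → mk⇔ (H.fwd-mono ∘ G.fwd-mono) (from (G.pres x y) ∘ from (H.pres _ _)) }
  where module G = Iso g
        module H = Iso h

module _ {A B : Structure} (h : A ≅ B) where
  open Iso h

  Sat-≅ : ∀ {n} (φ : Formula n) {ρ ρ'} → (∀ i → fwd (ρ i) ≡ ρ' i) → Sat A ρ φ ⇔ Sat B ρ' φ
  Sat-≅ (rel i j) e = mk⇔
    (λ s → subst₂ (_≺_ B) (e i) (e j) (fwd-mono s))
    (λ s → from (pres _ _) (subst₂ (_≺_ B) (sym (e i)) (sym (e j)) s))
  Sat-≅ (eq i j) e = mk⇔
    (λ s → trans (sym (e i)) (trans (cong fwd s) (e j)))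
    (λ s → fwd-injective (trans (e i) (trans s (sym (e j)))))
  Sat-≅ (neg φ) e = mk⇔ (_∘ from (Sat-≅ φ e)) (_∘ to (Sat-≅ φ e))
  Sat-≅ (φ ∧ ψ) e = mk⇔ (λ (s , t) → to (Sat-≅ φ e) s , to (Sat-≅ ψ e) t)
                         (λ (s , t) → from (Sat-≅ φ e) s , from (Sat-≅ ψ e) t)
  Sat-≅ (φ ∨ ψ) e = mk⇔ (Sum.map (to (Sat-≅ φ e)) (to (Sat-≅ ψ e)))
                         (Sum.map (from (Sat-≅ φ e)) (from (Sat-≅ ψ e)))
  Sat-≅ (⋀ f) e = mk⇔ (λ s k → to (Sat-≅ (f k) e) (s k)) (λ s k → from (Sat-≅ (f k) e) (s k))
  Sat-≅ (⋁ f) e = mk⇔ (λ (k , s) → k , to (Sat-≅ (f k) e) s)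
                       (λ (k , s) → k , from (Sat-≅ (f k) e) s)
  Sat-≅ (∃' φ) e = mk⇔
    (λ (a , s) → fwd a , to (Sat-≅ φ λ { zero → refl ; (suc i) → e i }) s)
    (λ (b , s) → bwd b , from (Sat-≅ φ λ { zero → strictlyInverseˡ b ; (suc i) → e i }) s)
  Sat-≅ (∀' φ) e = mk⇔
    (λ s b → to (Sat-≅ φ λ { zero → strictlyInverseˡ b ; (suc i) → e i }) (s (bwd b)))
    (λ s a → from (Sat-≅ φ λ { zero → refl ; (suc i) → e i }) (s (fwd a)))

Sat-resp : ∀ {n} A (φ : Formula n) {ρ ρ'} → (∀ i → ρ i ≡ ρ' i) → Sat A ρ φ → Sat A ρ' φ
Sat-resp A φ e = to (Sat-≅ (≅-refl {A}) φ e)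

extend-η : ∀ {n} {X : Set} (ρ : Fin (suc n) → X) i → ρ i ≡ extend (ρ zero) (ρ ∘ suc) i
extend-η ρ zero    = refl
extend-η ρ (suc i) = refl

∃^ : ∀ n → Formula n → Sentence
∃^ zero    φ = φ
∃^ (suc n) φ = ∃^ n (∃' φ)

∀^ : ∀ n → Formula n → Sentence
∀^ zero    φ = φ
∀^ (suc n) φ = ∀^ n (∀' φ)

ExPi-∃^ : ∀ {m} n {φ : Formula n} → ExPi m φ → ExPi m (∃^ n φ)
ExPi-∃^ zero    p = p
ExPi-∃^ (suc n) p = ExPi-∃^ n (ep-∃ p)

AllSig-∀^ : ∀ {m} n {φ : Formula n} → AllSig m φ → AllSig m (∀^ n φ)
AllSig-∀^ zero    p = p
AllSig-∀^ (suc n) p = AllSig-∀^ n (as-∀ p)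

Sat-∃^ : ∀ A n (φ : Formula n) → A ⊨ ∃^ n φ ⇔ (∃[ ρ ] Sat A ρ φ)
Sat-∃^ A zero φ = mk⇔ (emptyEnv ,_) λ (ρ , s) → Sat-resp A φ (λ ()) s
Sat-∃^ A (suc n) φ = mk⇔
  (λ s → let ρ , a , t = to (Sat-∃^ A n (∃' φ)) s in extend a ρ , t)
  (λ (ρ , s) → from (Sat-∃^ A n (∃' φ)) (ρ ∘ suc , ρ zero , Sat-resp A φ (extend-η ρ) s))

Sat-∀^ : ∀ A n (φ : Formula n) → A ⊨ ∀^ n φ ⇔ (∀ ρ → Sat A ρ φ)
Sat-∀^ A zero φ = mk⇔ (λ s ρ → Sat-resp A φ (λ ()) s) (λ s → s emptyEnv)
Sat-∀^ A (suc n) φ = mk⇔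
  (λ s ρ → Sat-resp A φ (λ i → sym (extend-η ρ i)) (to (Sat-∀^ A n (∀' φ)) s (ρ ∘ suc) (ρ zero)))
  (λ s → from (Sat-∀^ A n (∀' φ)) (λ ρ a → s (extend a ρ)))

-- The bound variables of the existential block become free variables, to be read as parameters.
matrix : ∀ {m n} {χ : Formula n} → ExPi m χ →
  Σ[ k ∈ ℕ ] Σ[ ψ ∈ Formula k ] (∃[ b ] (b ℕ.≤ m × Pi b ψ)) ×
    (∀ A ρ → Sat A ρ χ → ∃[ ρ' ] Sat A ρ' ψ) × (∀ A ρ' → Sat A ρ' ψ → ∃[ ρ ] Sat A ρ χ)
matrix {χ = χ} (ep-base {b} b≤m p) = _ , χ , (b , b≤m , p) , (λ A ρ s → ρ , s) , (λ A ρ s → ρ , s)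
matrix {χ = ∃' χ} (ep-∃ p) with matrix p
... | k , ψ , pi , down , up = k , ψ , pi ,
  (λ A ρ (a , s) → down A (extend a ρ) s) ,
  (λ A ρ' s → let ρ , t = up A ρ' s in ρ ∘ suc , ρ zero , Sat-resp A χ (extend-η ρ) t)

AllSig-mono : ∀ {m m' n} {ψ : Formula n} → m ℕ.≤ m' → AllSig m ψ → AllSig m' ψ
AllSig-mono m≤m' (as-base b≤m s) = as-base (ℕ.≤-trans b≤m m≤m') s
AllSig-mono m≤m' (as-∀ s)        = as-∀ (AllSig-mono m≤m' s)

conjuncts : ∀ {b n} {ψ : Formula n} → b ℕ.≤ 2 → Pi b ψ →
  Σ[ θ ∈ (ℕ → Formula n) ] (∀ i → AllSig 1 (θ i)) × (∀ A ρ → Sat A ρ ψ ⇔ (∀ i → Sat A ρ (θ i)))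
conjuncts {ψ = ψ} _ (pi0 q) =
  (λ _ → ψ) , (λ _ → as-base z≤n (sig0 q)) , λ A ρ → mk⇔ (λ s _ → s) (λ s → s 0)
conjuncts {ψ = ⋀ f} (s≤s m≤1) (pi⋀ p) =
  f , (λ i → AllSig-mono m≤1 (p i)) , λ A ρ → mk⇔ id id

-- Structures with parameters and the transfer of Π₂ theories

record Model {n : ℕ} (θ : ℕ → Formula n) : Set₁ where
  field
    str    : Structure
    linear : IsLinearOrdering str
    param  : Fin n → Carrier str
    sat    : ∀ i → Sat str param (θ i)

-- Q is an escape from the forth property.
module Forth {A B : Structure} {Q : Set}
  (R : ∀ {m} → (Fin m → Carrier A) → (Fin m → Carrier B) → Set)
  (R-rel : ∀ {m} {ρ : Fin m → _} {ρ'} → R ρ ρ' → ∀ i j → _≺_ A (ρ i) (ρ j) ⇔ _≺_ B (ρ' i) (ρ' j))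
  (R-eq : ∀ {m} {ρ : Fin m → _} {ρ'} → R ρ ρ' → ∀ i j → ρ i ≡ ρ j ⇔ ρ' i ≡ ρ' j)
  (forth : ∀ {m} {ρ : Fin m → _} {ρ'} → R ρ ρ' → ∀ a → Q ⊎ ∃[ b ] R (extend a ρ) (extend b ρ'))
  where

  -- An equivalence because of `neg`, and free of the escape because no quantifier asks for a new
  -- element. Existential formulas are positive above this level, so there an escape can be passed
  -- outwards.
  QF-transfer : ∀ {m} {φ : Formula m} {ρ ρ'} → QF φ → R ρ ρ' → Sat A ρ φ ⇔ Sat B ρ' φ
  QF-transfer (qf-rel i j) r = R-rel r i j
  QF-transfer (qf-eq i j)  r = R-eq r i j
  QF-transfer (qf-neg q)   r = mk⇔ (_∘ from (QF-transfer q r)) (_∘ to (QF-transfer q r))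
  QF-transfer (qf-∧ p q)   r = mk⇔
    (λ (s , t) → to (QF-transfer p r) s , to (QF-transfer q r) t)
    (λ (s , t) → from (QF-transfer p r) s , from (QF-transfer q r) t)
  QF-transfer (qf-∨ p q)   r = mk⇔
    (Sum.map (to (QF-transfer p r)) (to (QF-transfer q r)))
    (Sum.map (from (QF-transfer p r)) (from (QF-transfer q r)))

  ExPi-transfer : ∀ {m} {φ : Formula m} {ρ ρ'} → ExPi 0 φ → R ρ ρ' → Sat A ρ φ → Q ⊎ Sat B ρ' φ
  ExPi-transfer (ep-base z≤n (pi0 q)) r s = inj₂ (to (QF-transfer q r) s)
  ExPi-transfer (ep-∃ p) r (a , s) with forth r a
  ... | inj₁ q        = inj₁ q
  ... | inj₂ (b , r') = Sum.map₂ (b ,_) (ExPi-transfer p r' s)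

  Sig-transfer : ∀ {m c} {φ : Formula m} {ρ ρ'} → c ℕ.≤ 1 → Sig c φ → R ρ ρ' →
                 Sat A ρ φ → Q ⊎ Sat B ρ' φ
  Sig-transfer _         (sig0 q) r s       = inj₂ (to (QF-transfer q r) s)
  Sig-transfer (s≤s z≤n) (sig⋁ p) r (k , s) = Sum.map₂ (k ,_) (ExPi-transfer (p k) r s)

module _ {n : ℕ} (A : Structure) (a : Fin n → Carrier A) where

  -- Newly bound variables are put in front, so the parameters occupy the last `n` places.
  Agree : ∀ k → (Fin (k ℕ.+ n) → Carrier A) → Set
  Agree k ρ = ∀ i → ρ (k ↑ʳ i) ≡ a i

module _ {n : ℕ} {A B : Structure} {a : Fin n → Carrier A} {b : Fin n → Carrier B}
  (Σ₁-reflects : ∀ k {c} {τ : Formula (k ℕ.+ n)} → c ℕ.≤ 1 → Sig c τ →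
    (∀ ρ → Agree A a k ρ → Sat A ρ τ) → ∀ ρ' → Agree B b k ρ' → Sat B ρ' τ) where

  -- The universal quantifiers already stripped are counted by `k`. Preservation of a Π₂ theory
  -- thereby becomes a statement about a single tuple of `B` at a time, for which a suitable tuple
  -- of `A` may be chosen.
  AllSig-reflects : ∀ k {ψ : Formula (k ℕ.+ n)} → AllSig 1 ψ →
    (∀ ρ → Agree A a k ρ → Sat A ρ ψ) → ∀ ρ' → Agree B b k ρ' → Sat B ρ' ψ
  AllSig-reflects k (as-base c≤1 s) = Σ₁-reflects k c≤1 s
  AllSig-reflects k {∀' ψ} (as-∀ s) pf ρ' ag y = AllSig-reflects (suc k) s
    (λ ρ ag' → Sat-resp A ψ (λ i → sym (extend-η ρ i)) (pf (ρ ∘ suc) ag' (ρ zero)))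
    (extend y ρ') ag

  theory-transfer : {θ : ℕ → Formula n} → (∀ i → AllSig 1 (θ i)) →
    (∀ i → Sat A a (θ i)) → ∀ i → Sat B b (θ i)
  theory-transfer {θ} univ s i = AllSig-reflects 0 (univ i)
    (λ ρ ag → Sat-resp A (θ i) (sym ∘ ag) (s i)) b (λ _ → refl)

-- Enumerated models

-- Least witnesses are canonical. Stored with irrelevant proofs, they make hull elements and
-- `Evidence` unique.
least : {P : ℕ → Set} → Decidable P → ∀ {n} → P n → ∃[ m ] (P m × ∀ k → k ℕ.< m → ¬ P k)
least {P} P? {n} pn with below (suc n)
  where
  below : ∀ b → (∃[ m ] (P m × ∀ k → k ℕ.< m → ¬ P k)) ⊎ (∀ k → k ℕ.< b → ¬ P k)
  below zero = inj₂ λ _ ()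
  below (suc b) with below b | P? b
  ... | inj₁ found | _      = inj₁ found
  ... | inj₂ none  | yes pb = inj₁ (b , pb , none)
  ... | inj₂ none  | no ¬pb = inj₂ λ k k<1+b → Sum.[ none k , (λ { refl → ¬pb }) ] (ℕ.m<1+n⇒m<n∨m≡n k<1+b)
... | inj₁ found = found
... | inj₂ none  = ⊥-elim (none n (ℕ.n<1+n n) pn)

tuples : {X : Set} → ℕ → List X → List (List X)
tuples zero    xs = [] ∷ []
tuples (suc n) xs = [] ∷ concatMap (λ x → map (x ∷_) (tuples n xs)) xs

∈-tuples : {X : Set} {xs l : List X} → ∀ n → length l ℕ.≤ n → All (_∈ xs) l → l ∈ tuples n xs
∈-tuples zero    _         []         = here refl
∈-tuples (suc n) _         []         = here refl
∈-tuples (suc n) (s≤s len) (x∈ ∷ all) = there (∈-concatMap⁺ (λ x → map (x ∷_) (tuples n _))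
                                          (lose x∈ (∈-map⁺ (_ ∷_) (∈-tuples n len all))))

Enumerated : Structure → Set
Enumerated A = Σ[ L ∈ (ℕ → List (Carrier A)) ] (∀ x → ∃[ k ] x ∈ L k)

-- The Skolem functions are read off from the proof that the theory holds.
module Hull {n} {θ : ℕ → Formula n} (univ : ∀ i → AllSig 1 (θ i)) (M : Model θ) where
  open Model M renaming (str to A)
  private
    module A = IsStrictTotalOrder linear
    open DecMembership A._≟_ using (_∈?_)

  witnesses-ExPi : ∀ {m} {φ : Formula m} {ρ} → ExPi 0 φ → Sat A ρ φ → List (Carrier A)
  witnesses-ExPi (ep-base _ _) _       = []
  witnesses-ExPi (ep-∃ p)      (a , s) = a ∷ witnesses-ExPi p s

  witnesses-Sig : ∀ {m c} {φ : Formula m} {ρ} → c ℕ.≤ 1 → Sig c φ → Sat A ρ φ → List (Carrier A)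
  witnesses-Sig _         (sig0 _) _       = []
  witnesses-Sig (s≤s z≤n) (sig⋁ p) (k , s) = witnesses-ExPi (p k) s

  witnesses : ∀ {m} {φ : Formula m} {ρ} → AllSig 1 φ → Sat A ρ φ → List (Carrier A) → List (Carrier A)
  -- Lists stand for tuples of any length: surplus entries are ignored, and a list too short for the
  -- quantifier prefix yields no witnesses.
  witnesses (as-base c≤1 s) pf _       = witnesses-Sig c≤1 s pf
  witnesses (as-∀ s)        pf []      = []
  witnesses (as-∀ s)        pf (x ∷ l) = witnesses s (pf x) l

  answers : ℕ → ℕ → List (Carrier A) → List (Carrier A)
  answers k i xs = concatMap (witnesses (univ i) (sat i)) (tuples k xs)

  -- Dovetailing: each step serves finitely many axioms and tuples and so keeps the stage a list,
  -- while every axiom and every tuple has its turn.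
  stage : ℕ → List (Carrier A)
  stage zero    = tabulate param
  stage (suc k) = stage k ++ concatMap (λ i → answers k i (stage k)) (upTo k)

  stage-mono : ∀ {x} j k → x ∈ stage k → x ∈ stage (j ℕ.+ k)
  stage-mono zero    k x∈ = x∈
  stage-mono (suc j) k x∈ = ∈-++⁺ˡ (stage-mono j k x∈)

  Reached : Carrier A → Set
  Reached x = ∃[ k ] x ∈ stage k

  common-stage : ∀ {l} → All Reached l → ∃[ k ] All (_∈ stage k) l
  common-stage []                = 0 , []
  common-stage {x ∷ _} ((k , x∈) ∷ rest) with common-stage rest
  ... | k' , all = k ℕ.+ k' ,
    subst (λ m → x ∈ stage m) (ℕ.+-comm k' k) (stage-mono k' k x∈) ∷ All.map (stage-mono k k') all

  closed : ∀ i l → All Reached l → All Reached (witnesses (univ i) (sat i) l)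
  closed i l all with common-stage all
  ... | k , all∈ = All.tabulate λ y∈ → suc K , ∈-++⁺ʳ (stage K)
      (∈-concatMap⁺ (λ i → answers K i (stage K)) (lose (∈-upTo⁺ i<K)
        (∈-concatMap⁺ (witnesses (univ i) (sat i)) (lose (∈-tuples K len all∈K) y∈))))
    where
    -- Large enough to exceed the index of the axiom, to bound the length of the tuple, and to have
    -- all its entries present.
    K = (suc i ℕ.+ length l) ℕ.+ k
    i<K : i ℕ.< K
    i<K = ℕ.≤-trans (ℕ.m≤m+n (suc i) (length l)) (ℕ.m≤m+n _ k)
    len : length l ℕ.≤ K
    len = ℕ.≤-trans (ℕ.m≤n+m (length l) (suc i)) (ℕ.m≤m+n _ k)
    all∈K : All (_∈ stage K) l
    all∈K = All.map (stage-mono (suc i ℕ.+ length l) k) all∈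

  -- Recording the first stage at which the value appears, with irrelevant proofs, makes an element
  -- depend on its value alone. Membership in a list is decidable, so `found` can be recomputed.
  record Element : Set where
    constructor element
    field
      value  : Carrier A
      level  : ℕ
      .found : value ∈ stage level
      .first : ∀ k → k ℕ.< level → ¬ value ∈ stage k
  open Element

  value-injective : ∀ {h h'} → value h ≡ value h' → h ≡ h'
  value-injective {element x k f m} {element .x k' f' m'} refl with ℕ.<-cmp k k'
  ... | tri< k<k' _ _ = ⊥-elim-irr (m' k k<k' f)
  ... | tri≈ _ refl _ = refl
  ... | tri> _ _ k'<k = ⊥-elim-irr (m k' k'<k f')

  reach : ∀ {x} → Reached x → Element
  reach {x} (k , x∈) with least {λ k → x ∈ stage k} (λ k → x ∈? stage k) {k} x∈
  ... | m , x∈m , first = element x m x∈m first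

  value-reach : ∀ {x} (r : Reached x) → value (reach r) ≡ x
  value-reach {x} (k , x∈) with least {λ k → x ∈ stage k} (λ k → x ∈? stage k) {k} x∈
  ... | m , x∈m , first = refl

  reached : ∀ h → Reached (value h)
  reached (element x k found _) = k , recompute (x ∈? stage k) found

  hull : Structure
  hull = record
    { Carrier = Element
    ; _≺_     = _≺_ A on value
    ; enc     = enc A ∘ value
    ; enc-inj = value-injective ∘ enc-inj A
    }

  hull-linear : IsLinearOrdering hull
  hull-linear = isStrictTotalOrderᶜ record
    { isEquivalence = isEquivalence
    ; trans = A.trans
    ; compare = λ h h' → case (A.compare (value h) (value h'))
    }
    where
    case : ∀ {h h'} → Tri (_≺_ A (value h) (value h')) (value h ≡ value h') (_≺_ A (value h') (value h)) →
           Tri (_≺_ A (value h) (value h')) (h ≡ h') (_≺_ A (value h') (value h))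
    case (tri< a b c) = tri< a (b ∘ cong value) c
    case (tri≈ a b c) = tri≈ a (value-injective b) c
    case (tri> a b c) = tri> a (b ∘ cong value) c

  Lifts : ∀ {m} → (Fin m → Carrier A) → (Fin m → Element) → Set
  Lifts ρ ρ' = ∀ i → ρ i ≡ value (ρ' i)

  -- Only the quantifier-free transfer is taken from here, so the forth step may always escape
  -- trivially.
  open Forth {A} {hull} {⊤} Lifts
    (λ r i j → mk⇔ (subst₂ (_≺_ A) (r i) (r j)) (subst₂ (_≺_ A) (sym (r i)) (sym (r j))))
    (λ {_} {_} {ρ'} r i j → mk⇔ (λ e → value-injective {ρ' i} {ρ' j} (trans (sym (r i)) (trans e (r j))))
                   (λ e → trans (r i) (trans (cong value e) (sym (r j)))))
    (λ _ _ → inj₁ tt)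
    using (QF-transfer)

  lifts-extend : ∀ {m} {ρ : Fin m → Carrier A} {ρ'} {x h} → x ≡ value h → Lifts ρ ρ' →
                 Lifts (extend x ρ) (extend h ρ')
  lifts-extend e r zero    = e
  lifts-extend e r (suc i) = r i

  hull-ExPi : ∀ {m} {φ : Formula m} {ρ ρ'} (p : ExPi 0 φ) (s : Sat A ρ φ) → Lifts ρ ρ' →
              All Reached (witnesses-ExPi p s) → Sat hull ρ' φ
  hull-ExPi (ep-base z≤n (pi0 q)) s r _ = to (QF-transfer q r) s
  hull-ExPi (ep-∃ p) (a , s) r (ra ∷ all) =
    reach ra , hull-ExPi p s (lifts-extend (sym (value-reach ra)) r) all

  hull-Sig : ∀ {m c} {φ : Formula m} {ρ ρ'} (c≤1 : c ℕ.≤ 1) (p : Sig c φ) (s : Sat A ρ φ) → Lifts ρ ρ' →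
             All Reached (witnesses-Sig c≤1 p s) → Sat hull ρ' φ
  hull-Sig _         (sig0 q) s       r _   = to (QF-transfer q r) s
  hull-Sig (s≤s z≤n) (sig⋁ p) (k , s) r all = k , hull-ExPi (p k) s r all

  hull-AllSig : ∀ {m} {φ : Formula m} {ρ ρ'} (p : AllSig 1 φ) (s : Sat A ρ φ) → Lifts ρ ρ' →
                (∀ l → All Reached l → All Reached (witnesses p s l)) → Sat hull ρ' φ
  hull-AllSig (as-base c≤1 p) s r cl   = hull-Sig c≤1 p s r (cl [] [])
  hull-AllSig (as-∀ p)        s r cl h = hull-AllSig p (s (value h)) (lifts-extend refl r)
                                           (λ l all → cl (value h ∷ l) (reached h ∷ all))

  base-point : ∀ j → Reached (param j)
  base-point j = 0 , ∈-tabulate⁺ j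

  hullModel : Model θ
  hullModel = record
    { str    = hull
    ; linear = hull-linear
    ; param  = reach ∘ base-point
    ; sat    = λ i → hull-AllSig (univ i) (sat i) (λ j → sym (value-reach (base-point j))) (closed i)
    }

  hull-enumerated : Enumerated hull
  hull-enumerated = (λ k → mapWith∈ (stage k) (λ x∈ → reach (k , x∈)))
    , λ h → level h , mapWith∈⁺ (λ {x} x∈ → reach {x} (level h , x∈)) (value h , proj₂ (reached h) ,
                        value-injective (sym (value-reach (reached h))))

-- Adjoining endpoints, and refilling a gap

module Ends (A : Structure) (lin : IsLinearOrdering A) where
  open Strict (_≺_ A) public
    using (_<±_; ⊥±<[_]; ⊥±<⊤±; [_]<⊤±) renaming ([_] to lift; [<]-injective to lower)

  sto : IsStrictTotalOrder _≡_ _<±_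
  sto = Strict.<±-isStrictTotalOrder-≡ (_≺_ A) lin

  open LinearOrder sto public

  ≮⊥ : ∀ {e} → ¬ (e <± ⊥±)
  ≮⊥ {⊥±}    p = <-irr p
  ≮⊥ {[ x ]} p = asym p ⊥±<[ x ]
  ≮⊥ {⊤±}    p = asym p ⊥±<⊤±

  ⊤≮ : ∀ {e} → ¬ (⊤± <± e)
  ⊤≮ {⊥±}    p = asym p ⊥±<⊤±
  ⊤≮ {[ x ]} p = asym p [ x ]<⊤±
  ⊤≮ {⊤±}    p = <-irr p

  ≤⊤ : ∀ {e} → e ≤ ⊤±
  ≤⊤ {⊥±}    = inj₁ ⊥±<⊤±
  ≤⊤ {[ x ]} = inj₁ [ x ]<⊤±
  ≤⊤ {⊤±}    = ≤-refl

  point : ∀ {l u e} → Between l u e → ∃[ x ] e ≡ [ x ]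
  point {e = ⊥±}    i = ⊥-elim (≮⊥ (proj₁ i))
  point {e = [ x ]} i = x , refl
  point {e = ⊤±}    i = ⊥-elim (⊤≮ (proj₂ i))

map± : {X Y : Set} → (X → Y) → X ± → Y ±
map± f ⊥±    = ⊥±
map± f [ x ] = [ f x ]
map± f ⊤±    = ⊤±

map±-inverse : {X Y : Set} (f : X → Y) (g : Y → X) → (∀ x → g (f x) ≡ x) →
               ∀ e → map± g (map± f e) ≡ e
map±-inverse f g inv ⊥±    = refl
map±-inverse f g inv [ x ] = cong [_] (inv x)
map±-inverse f g inv ⊤±    = refl

module _ {X Y : Set} {_<₁_ : X → X → Set} {_<₂_ : Y → Y → Set} where
  open Strict

  map±-mono : {f : X → Y} → (∀ {x y} → x <₁ y → f x <₂ f y) →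
              ∀ {e e'} → _<±_ _<₁_ e e' → _<±_ _<₂_ (map± f e) (map± f e')
  map±-mono mono ⊥±<[ y ] = ⊥±<[ _ ]
  map±-mono mono ⊥±<⊤±    = ⊥±<⊤±
  map±-mono mono [ y ]<⊤± = [ _ ]<⊤±
  map±-mono mono Strict.[ p ] = Strict.[ mono p ]

module Splice (A : Structure) (lin : IsLinearOrdering A) (l u : Carrier A ±) where
  open Ends A lin

  Inside : Carrier A ± → Set
  Inside = Between l u

  data Spliced (New : Set) : Set where
    out : (x : Carrier A) → .(¬ Inside [ x ]) → Spliced New
    new : New → Spliced New

  out-≡ : ∀ {New x y} .{¬i : ¬ Inside [ x ]} .{¬j : ¬ Inside [ y ]} →
          x ≡ y ⇔ out {New} x ¬i ≡ out y ¬j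
  out-≡ = mk⇔ (λ { refl → refl }) (λ { refl → refl })

  inside? : ∀ e → Dec (Inside e)
  inside? = between? l u

  ¬inside-recompute : ∀ {e} → .(¬ Inside e) → ¬ Inside e
  ¬inside-recompute ¬i i = ⊥-elim-irr (¬i i)

  l-outside : ¬ Inside l
  l-outside (l<l , _) = <-irr l<l

  u-outside : ¬ Inside u
  u-outside (_ , u<u) = <-irr u<u

  ≤l⇒outside : ∀ {e} → e ≤ l → ¬ Inside e
  ≤l⇒outside e≤l (l<e , _) = <⇒≱ l<e e≤l

  u≤⇒outside : ∀ {e} → u ≤ e → ¬ Inside e
  u≤⇒outside u≤e (_ , e<u) = <⇒≱ e<u u≤e

  -- The value at elements inside the gap is junk.
  keep : ∀ {New} → Carrier A ± → Spliced New ±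
  keep ⊥± = ⊥±
  keep ⊤± = ⊤±
  keep [ x ] with inside? [ x ]
  ... | yes _ = ⊥±
  ... | no ¬i = [ out x ¬i ]

  keep-out : ∀ {New} x .(¬i : ¬ Inside [ x ]) → keep {New} [ x ] ≡ [ out x ¬i ]
  keep-out x ¬i with inside? [ x ]
  ... | yes i = ⊥-elim-irr (¬i i)
  ... | no _  = refl

  -- Common to both refillings, which differ only in where the new points are placed.
  module Order {New : Set} (_<_ : Spliced New → Spliced New → Set)
    (sto' : IsStrictTotalOrder _≡_ _<_)
    (out-< : ∀ {x y} .{¬i : ¬ Inside [ x ]} .{¬j : ¬ Inside [ y ]} → out x ¬i < out y ¬j ⇔ _≺_ A x y)
    where
    open Strict _<_ using () renaming (_<±_ to _<'_)
    private
      module S = LinearOrder (Strict.<±-isStrictTotalOrder-≡ _<_ sto')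

    keep-mono : ∀ {e e'} → ¬ Inside e → ¬ Inside e' → e <± e' → keep e <' keep e'
    keep-mono {_}     {⊥±}    _ _  p = ⊥-elim (≮⊥ p)
    keep-mono {⊥±}    {[ y ]} _ ¬j _ rewrite keep-out {New} y ¬j = Strict.⊥±<[ _ ]
    keep-mono {⊥±}    {⊤±}    _ _  _ = Strict.⊥±<⊤±
    keep-mono {[ x ]} {⊤±}    ¬i _ _ rewrite keep-out {New} x ¬i = Strict.[ _ ]<⊤±
    keep-mono {[ x ]} {[ y ]} ¬i ¬j p rewrite keep-out {New} x ¬i | keep-out {New} y ¬j =
      Strict.[ from out-< (lower p) ]

    keep-reflect : ∀ {e e'} → ¬ Inside e → ¬ Inside e' → keep e <' keep e' → e <± e'
    keep-reflect {e} {e'} ¬i ¬j p with <-or-≥ e e'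
    ... | inj₁ e<e'         = e<e'
    ... | inj₂ (inj₁ e'<e)  = ⊥-elim (S.asym p (keep-mono ¬j ¬i e'<e))
    ... | inj₂ (inj₂ refl) = ⊥-elim (S.<-irr p)

    -- New points can indeed lie below `keep l`: if the adversary trades the lower endpoint `c` for
    -- `w`, the kept copy of `c` moves up to the place of `w`, and the point `w` comes to lie below
    -- it.
    module _ {P : Set} (new⇒P : ∀ i → [ new i ] <' keep l → P) where
      open Transport sto (Strict.<±-isStrictTotalOrder-≡ _<_ sto')

      below-mono : MonoBelow l keep
      below-mono x<y y≤l = keep-mono (≤l⇒outside (inj₁ (<-≤-trans x<y y≤l))) (≤l⇒outside y≤l) x<y

      below-onto : OntoBelow P l keep
      below-onto ⊥± p = inj₂ (⊥± , keep-reflect {⊥±} (≮⊥ ∘ proj₁) l-outside p , refl)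
      below-onto [ out x ¬i ] p = inj₂ ([ x ] ,
        keep-reflect (¬inside-recompute ¬i) l-outside (subst (_<' keep l) (sym (keep-out x ¬i)) p) ,
        keep-out x ¬i)
      below-onto [ new i ] p = inj₁ (new⇒P i p)

      keep-Known : ∀ {k} → Known ⊥ k l → S.Known P k (keep l)
      keep-Known = transport keep below-mono below-onto

      keep-Mem : ∀ {k} (K : Known ⊥ k l) {e} → Mem e K → S.Mem (keep e) (keep-Known K)
      keep-Mem = transport-Mem keep below-mono below-onto

tri-map : {P Q R P' Q' R' : Set} → P ⇔ P' → Q ⇔ Q' → R ⇔ R' → Tri P Q R → Tri P' Q' R'
tri-map p q r (tri< a ¬b ¬c) = tri< (to p a) (¬b ∘ from q) (¬c ∘ from r)
tri-map p q r (tri≈ ¬a b ¬c) = tri≈ (¬a ∘ from p) (to q b) (¬c ∘ from r)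
tri-map p q r (tri> ¬a ¬b c) = tri> (¬a ∘ from p) (¬b ∘ from q) (to r c)

-- The adversary: (l , u) is kept empty until an element of it has been found; from then on
-- the structure is A with that element and the endpoint c trading places.
module Adversary {n} {θ : ℕ → Formula n} (univ : ∀ i → AllSig 1 (θ i)) (M : Model θ)
  (enumerated : Enumerated (Model.str M))
  {l u : Carrier (Model.str M) ±} (l<u : Ends._<±_ (Model.str M) (Model.linear M) l u)
  (c : Carrier (Model.str M)) (endpoint : l ≡ [ c ] ⊎ u ≡ [ c ])
  (params-outside : ∀ j → ¬ Splice.Inside (Model.str M) (Model.linear M) l u [ Model.param M j ])
  (c-not-param : ∀ j → Model.param M j ≢ c) where

  open Model M renaming (str to A)
  open Ends A linear
  open Splice A linear l u
  private
    module A = IsStrictTotalOrder linear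

  In : Carrier A → Set
  In x = Inside [ x ]

  ∉In-trade : ∀ {x w} → ¬ In x → In w → x ≢ w
  ∉In-trade x∉ w∈ refl = x∉ w∈

  c∉In : ¬ In c
  c∉In i = go endpoint
    where
    go : l ≡ [ c ] ⊎ u ≡ [ c ] → ⊥
    go (inj₁ refl) = l-outside i
    go (inj₂ refl) = u-outside i

  HitAt : ℕ → Set
  HitAt k = Any In (proj₁ enumerated k)

  hitAt? : Decidable HitAt
  hitAt? k = any? (inside? ∘ [_]) (proj₁ enumerated k)

  -- Unique because it names the first stage of the enumeration that meets the gap. The order of the
  -- adversary and its new points therefore do not depend on how the evidence was obtained.
  data Evidence : Set where
    evidence : (k : ℕ) .(hit : HitAt k) .(first : ∀ j → j ℕ.< k → ¬ HitAt j) → Evidence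

  evidence-unique : (p q : Evidence) → p ≡ q
  evidence-unique (evidence j h f) (evidence k h' f') with ℕ.<-cmp j k
  ... | tri< j<k _ _  = ⊥-elim-irr (f' j j<k h)
  ... | tri≈ _ refl _ = refl
  ... | tri> _ _ k<j  = ⊥-elim-irr (f k k<j h')

  find : ∀ {x} → In x → Evidence
  find {x} i with proj₂ enumerated x
  ... | k , x∈ with least hitAt? {k} (lose x∈ i)
  ... | m , hit , first = evidence m hit first

  found : Evidence → ∃ In
  found (evidence k hit _) = satisfied (recompute (hitAt? k) hit)

  module Trade (w : Carrier A) where

    trade : Carrier A → Carrier A
    trade x with x A.≟ c | x A.≟ w
    ... | yes _ | _     = w
    ... | no _  | yes _ = c
    ... | no _  | no _  = x

    trade-c : trade c ≡ w
    trade-c with c A.≟ c | c A.≟ w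
    ... | yes _  | _ = refl
    ... | no c≢c | _ = ⊥-elim (c≢c refl)

    trade-w : trade w ≡ c
    trade-w with w A.≟ c | w A.≟ w
    ... | yes refl | _      = refl
    ... | no _     | yes _  = refl
    ... | no _     | no w≢w = ⊥-elim (w≢w refl)

    trade-other : ∀ {x} → x ≢ c → x ≢ w → trade x ≡ x
    trade-other {x} x≢c x≢w with x A.≟ c | x A.≟ w
    ... | yes x≡c | _       = ⊥-elim (x≢c x≡c)
    ... | no _    | yes x≡w = ⊥-elim (x≢w x≡w)
    ... | no _    | no _    = refl

    trade-involutive : ∀ x → trade (trade x) ≡ x
    trade-involutive x with x A.≟ c | x A.≟ w
    ... | yes refl | _        = trade-w
    ... | no _     | yes refl = trade-c
    ... | no x≢c   | no x≢w   = trade-other x≢c x≢w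

    trade-injective : ∀ {x y} → trade x ≡ trade y → x ≡ y
    trade-injective {x} {y} e =
      trans (sym (trade-involutive x)) (trans (cong trade e) (trade-involutive y))

    module _ (w∈ : In w) where

      -- No point outside the gap lies between its endpoint `c` and its element `w`, so relative to
      -- the outside points `w` can stand in for `c`.
      trade-mono : ∀ {x y} → ¬ In x → ¬ In y → _≺_ A x y → _≺_ A (trade x) (trade y)
      trade-mono {x} {y} x∉ y∉ x≺y = go (x A.≟ c) (y A.≟ c)
        where
        above : x ≡ c → l ≡ [ c ] ⊎ u ≡ [ c ] → [ w ] <± [ y ]
        above refl (inj₂ refl) = <-trans (proj₂ w∈) (lift x≺y)
        above refl (inj₁ refl) with outside y∉
        ... | inj₁ y≤l = ⊥-elim (<⇒≱ (lift x≺y) y≤l)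
        ... | inj₂ u≤y = <-≤-trans (proj₂ w∈) u≤y

        below : y ≡ c → l ≡ [ c ] ⊎ u ≡ [ c ] → [ x ] <± [ w ]
        below refl (inj₁ refl) = <-trans (lift x≺y) (proj₁ w∈)
        below refl (inj₂ refl) with outside x∉
        ... | inj₁ x≤l = ≤-<-trans x≤l (proj₁ w∈)
        ... | inj₂ u≤x = ⊥-elim (<⇒≱ (lift x≺y) u≤x)

        trade-x : x ≢ c → trade x ≡ x
        trade-x x≢c = trade-other x≢c (∉In-trade x∉ w∈)

        trade-y : y ≢ c → trade y ≡ y
        trade-y y≢c = trade-other y≢c (∉In-trade y∉ w∈)

        go : Dec (x ≡ c) → Dec (y ≡ c) → _≺_ A (trade x) (trade y)
        go (yes x≡c) (yes y≡c) = ⊥-elim (A.irrefl (trans x≡c (sym y≡c)) x≺y)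
        go (no x≢c)  (no y≢c)  = subst₂ (_≺_ A) (sym (trade-x x≢c)) (sym (trade-y y≢c)) x≺y
        go (yes x≡c) (no y≢c)  = subst₂ (_≺_ A) (sym (trans (cong trade x≡c) trade-c))
                                   (sym (trade-y y≢c)) (lower (above x≡c endpoint))
        go (no x≢c)  (yes y≡c) = subst₂ (_≺_ A) (sym (trade-x x≢c))
                                   (sym (trans (cong trade y≡c) trade-c)) (lower (below y≡c endpoint))

      trade-reflect : ∀ {x y} → ¬ In x → ¬ In y → _≺_ A (trade x) (trade y) → _≺_ A x y
      trade-reflect {x} {y} x∉ y∉ p with A.compare x y
      ... | tri< x≺y _ _  = x≺y
      ... | tri≈ _ refl _ = ⊥-elim (A.irrefl refl p)
      ... | tri> _ _ y≺x  = ⊥-elim (A.asym p (trade-mono y∉ x∉ y≺x))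

  data Late : Set where
    late : (x : Carrier A) .(i : In x) (p : Evidence) → Late

  Elt : Set
  Elt = Spliced Late

  underlying : Elt → Carrier A
  underlying (out x _)          = x
  underlying (new (late x _ _)) = x

  underlying-injective : ∀ {b b'} → underlying b ≡ underlying b' → b ≡ b'
  underlying-injective {out x _}          {out .x _}          refl = refl
  underlying-injective {out x ¬i}         {new (late .x i _)} refl = ⊥-elim-irr (¬i i)
  underlying-injective {new (late x i _)} {out .x ¬i}         refl = ⊥-elim-irr (¬i i)
  underlying-injective {new (late x _ p)} {new (late .x _ q)} refl with evidence-unique p q
  ... | refl = refl

  role : Evidence → Elt → Carrier A
  role p b = Trade.trade (proj₁ (found p)) (underlying b)

  role-injective : ∀ p {b b'} → role p b ≡ role p b' → b ≡ b'
  role-injective p e = underlying-injective (Trade.trade-injective (proj₁ (found p)) e)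

  -- The comparison of two kept points mentions no evidence and so makes sense before any is found;
  -- by `trade-mono` it agrees with the comparison of roles afterwards. A new point brings along the
  -- evidence by which its role is determined.
  _<B_ : Elt → Elt → Set
  out x _                <B out y _                = _≺_ A x y
  b@(out _ _)            <B b'@(new (late _ _ p)) = _≺_ A (role p b) (role p b')
  b@(new (late _ _ p)) <B b'                      = _≺_ A (role p b) (role p b')

  role-⇔ : ∀ p b b' → b <B b' ⇔ _≺_ A (role p b) (role p b')
  role-⇔ p (out x x∉) (out y y∉) = mk⇔ (trade-mono w∈ x∉' y∉') (trade-reflect w∈ x∉' y∉')
    where
    open Trade (proj₁ (found p))
    w∈  = proj₂ (found p)
    x∉' = ¬inside-recompute x∉
    y∉' = ¬inside-recompute y∉
  role-⇔ p (out _ _) (new (late _ _ q)) with evidence-unique p q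
  ... | refl = mk⇔ id id
  role-⇔ p (new (late _ _ q)) b' with evidence-unique p q
  ... | refl = mk⇔ id id

  <B-trans : ∀ {b₁ b₂ b₃} → b₁ <B b₂ → b₂ <B b₃ → b₁ <B b₃
  <B-trans {b₁} {b₂} {b₃} = go b₁ b₂ b₃
    where
    via : Evidence → ∀ b₁ b₂ b₃ → b₁ <B b₂ → b₂ <B b₃ → b₁ <B b₃
    via p b₁ b₂ b₃ s t = from (role-⇔ p b₁ b₃) (A.trans (to (role-⇔ p b₁ b₂) s) (to (role-⇔ p b₂ b₃) t))

    go : ∀ b₁ b₂ b₃ → b₁ <B b₂ → b₂ <B b₃ → b₁ <B b₃
    go (out _ _) (out _ _) (out _ _) = A.trans
    go b₁@(new (late _ _ p)) b₂ b₃ = via p b₁ b₂ b₃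
    go b₁@(out _ _) b₂@(new (late _ _ p)) b₃ = via p b₁ b₂ b₃
    go b₁@(out _ _) b₂@(out _ _) b₃@(new (late _ _ p)) = via p b₁ b₂ b₃

  <B-compare : ∀ b b' → Tri (b <B b') (b ≡ b') (b' <B b)
  <B-compare = go
    where
    via : Evidence → ∀ b b' → Tri (b <B b') (b ≡ b') (b' <B b)
    via p b b' = tri-map
      (mk⇔ (from (role-⇔ p b b')) (to (role-⇔ p b b')))
      (mk⇔ (role-injective p) (cong (role p)))
      (mk⇔ (from (role-⇔ p b' b)) (to (role-⇔ p b' b)))
      (A.compare (role p b) (role p b'))

    go : ∀ b b' → Tri (b <B b') (b ≡ b') (b' <B b)
    go (out x x∉) (out y y∉) = tri-map
      (mk⇔ id id) out-≡ (mk⇔ id id) (A.compare x y)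
    go b@(new (late _ _ p)) b' = via p b b'
    go b@(out _ _) b'@(new (late _ _ p)) = via p b b'

  B : Structure
  B = record
    { Carrier = Elt
    ; _≺_     = _<B_
    ; enc     = enc A ∘ underlying
    ; enc-inj = underlying-injective ∘ enc-inj A
    }

  B-linear : IsLinearOrdering B
  B-linear = isStrictTotalOrderᶜ record
    { isEquivalence = isEquivalence
    ; trans         = λ {b₁} {b₂} {b₃} → <B-trans {b₁} {b₂} {b₃}
    ; compare       = <B-compare
    }

  settle : Evidence → Carrier A → Elt
  settle p x with inside? [ x ]
  ... | yes i = new (late x i p)
  ... | no ¬i = out x ¬i

  underlying-settle : ∀ p x → underlying (settle p x) ≡ x
  underlying-settle p x with inside? [ x ]
  ... | yes i = refl
  ... | no ¬i = refl

  role-iso : Evidence → B ≅ A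
  role-iso p = record
    { iso  = mk↔ₛ′ (role p) (settle p ∘ trade)
               (λ x → trans (cong trade (underlying-settle p (trade x))) (trade-involutive x))
               (λ b → underlying-injective (trans (underlying-settle p _) (trade-involutive _)))
    ; pres = role-⇔ p
    }
    where open Trade (proj₁ (found p))

  paramB : Fin n → Elt
  paramB j = out (param j) (params-outside j)

  role-param : ∀ p j → role p (paramB j) ≡ param j
  role-param p j = Trade.trade-other (proj₁ (found p)) (c-not-param j)
    (∉In-trade (params-outside j) (proj₂ (found p)))

  IsOut : Carrier A → Elt → Set
  IsOut x b = Σ[ ¬i ∈ ¬ In x ] b ≡ out x ¬i

  AllOut : ∀ {m} → (Fin m → Carrier A) → (Fin m → Elt) → Set
  AllOut ρ ρ' = ∀ i → IsOut (ρ i) (ρ' i)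

  forth : ∀ {m} {ρ : Fin m → Carrier A} {ρ'} → AllOut ρ ρ' → ∀ a →
          Evidence ⊎ ∃[ b ] AllOut (extend a ρ) (extend b ρ')
  forth r a with inside? [ a ]
  ... | yes i = inj₁ (find i)
  ... | no ¬i = inj₂ (out a ¬i , λ { zero → ¬i , refl ; (suc j) → r j })

  open Forth {A} {B} {Evidence} AllOut
    (λ r i j → subst₂ (λ b b' → _ ⇔ (b <B b')) (sym (proj₂ (r i))) (sym (proj₂ (r j))) (mk⇔ id id))
    (λ r i j → subst₂ (λ b b' → _ ⇔ (b ≡ b')) (sym (proj₂ (r i))) (sym (proj₂ (r j))) out-≡)
    forth

  allOut? : ∀ {m} (ρ' : Fin m → Elt) → Evidence ⊎ AllOut (underlying ∘ ρ') ρ'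
  allOut? {zero}  ρ' = inj₂ λ ()
  allOut? {suc m} ρ' with ρ' zero in eq | allOut? (ρ' ∘ suc)
  ... | new (late _ _ p) | _      = inj₁ p
  ... | out _ _          | inj₁ p = inj₁ p
  ... | out x x∉         | inj₂ r = inj₂ λ
    { zero    → subst (λ b → IsOut (underlying b) b) (sym eq) (¬inside-recompute x∉ , refl)
    ; (suc i) → r i }

  -- Given evidence, `B` is a copy of `A` over the parameters. Without it the tuple consists of kept
  -- points, and truth in `A` carries over unless a witness falls into the gap, in which case that
  -- witness is evidence.
  B-reflects : ∀ k {d} {τ : Formula (k ℕ.+ n)} → d ℕ.≤ 1 → Sig d τ →
    (∀ ρ → Agree A param k ρ → Sat A ρ τ) → ∀ ρ' → Agree B paramB k ρ' → Sat B ρ' τ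
  B-reflects k {τ = τ} d≤1 s pf ρ' ag = Sum.[ viaRole , viaOut ]′ (allOut? ρ')
    where
    viaRole : Evidence → Sat B ρ' τ
    viaRole p = from (Sat-≅ (role-iso p) τ (λ _ → refl))
      (pf (role p ∘ ρ') λ i → trans (cong (role p) (ag i)) (role-param p i))

    viaOut : AllOut (underlying ∘ ρ') ρ' → Sat B ρ' τ
    viaOut r = Sum.[ viaRole , id ]
      (Sig-transfer d≤1 s r (pf (underlying ∘ ρ') (cong underlying ∘ ag)))

  adversary : Model θ
  adversary = record
    { str    = B
    ; linear = B-linear
    ; param  = paramB
    ; sat    = theory-transfer B-reflects univ sat
    }

  module _ {k} (K : Known ⊥ k l) (h : A ≅ B) where
    private
      module EB = Ends B B-linear
    open Order _<B_ B-linear (mk⇔ id id)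
    open Iso h

    -- By `fixed` the isomorphism sends both endpoints to their kept copies. Composed with the roles
    -- it sends `c` to `w` and fixes the other endpoint.
    module Moved (p : Evidence) (fixed : map± fwd l ≡ keep l × map± fwd u ≡ keep u) where
      private
        w  = proj₁ (found p)
        w∈ = proj₂ (found p)
      open Trade w

      σ : Carrier A → Carrier A
      σ x = role p (fwd x)

      σ-mono : ∀ {e e'} → e <± e' → map± σ e <± map± σ e'
      σ-mono = map±-mono λ {x} {y} → to (role-⇔ p (fwd x) (fwd y)) ∘ fwd-mono

      σ-fixes : ∀ {e} → ¬ Inside e → e ≢ [ c ] → map± fwd e ≡ keep e → map± σ e ≡ e
      σ-fixes {⊥±}    _  _   _  = refl
      σ-fixes {⊤±}    _  _   _  = refl
      σ-fixes {[ x ]} x∉ x≢c e with [_]-injective (trans e (keep-out x x∉))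
      ... | e' = cong [_] (trans (cong (role p) e')
                   (trade-other (x≢c ∘ cong [_]) (∉In-trade x∉ w∈)))

      σ-c : map± fwd [ c ] ≡ keep [ c ] → σ c ≡ w
      σ-c e = trans (cong (role p) ([_]-injective (trans e (keep-out c c∉In)))) trade-c

      orbit : ℕ → Carrier A
      orbit zero    = w
      orbit (suc k) = σ (orbit k)

      rising : [ c ] <± [ w ] → σ c ≡ w → ∀ k → [ orbit k ] <± [ orbit (suc k) ]
      rising c<w σc≡w zero    = subst (λ y → [ y ] <± [ σ w ]) σc≡w (σ-mono c<w)
      rising c<w σc≡w (suc k) = σ-mono (rising c<w σc≡w k)

      falling : [ w ] <± [ c ] → σ c ≡ w → ∀ k → [ orbit (suc k) ] <± [ orbit k ]
      falling w<c σc≡w zero    = subst (λ y → [ σ w ] <± [ y ]) σc≡w (σ-mono w<c)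
      falling w<c σc≡w (suc k) = σ-mono (falling w<c σc≡w k)

      orbit-inside : ∀ {e} → map± σ e ≡ e →
        ([ w ] <± e → ∀ k → [ orbit k ] <± e) × (e <± [ w ] → ∀ k → e <± [ orbit k ])
      orbit-inside {e} σe≡e = below , above
        where
        below : [ w ] <± e → ∀ k → [ orbit k ] <± e
        below w<e zero    = w<e
        below w<e (suc k) = subst ([ orbit (suc k) ] <±_) σe≡e (σ-mono (below w<e k))

        above : e <± [ w ] → ∀ k → e <± [ orbit k ]
        above e<w zero    = e<w
        above e<w (suc k) = subst (_<± [ orbit (suc k) ]) σe≡e (σ-mono (above e<w k))

      climb : l ≡ [ c ] → ∀ k → Chain k l [ orbit k ]
      climb l≡c zero    = nil (proj₁ w∈)
      climb l≡c (suc k) = chain-snoc (climb l≡c k) (rising (subst (_<± [ w ]) l≡c (proj₁ w∈))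
        (σ-c (subst (λ e → map± fwd e ≡ keep e) l≡c (proj₁ fixed))) k)

      descend : u ≡ [ c ] → ∀ k → Chain k [ orbit k ] u
      descend u≡c zero    = nil (proj₂ w∈)
      descend u≡c (suc k) = cons _ (falling (subst ([ w ] <±_) u≡c (proj₂ w∈))
        (σ-c (subst (λ e → map± fwd e ≡ keep e) u≡c (proj₂ fixed))) k) (descend u≡c k)

      -- The orbit of `w` moves away from `c` and never passes the opposite endpoint, which `σ`
      -- fixes.
      unbounded : l ≡ [ c ] ⊎ u ≡ [ c ] → ∀ m → Chain m l u
      unbounded (inj₁ l≡c) m = chain-upper (inj₁ (orbit<u m)) (climb l≡c m)
        where
        orbit<u = proj₁ (orbit-inside (σ-fixes u-outside
          (λ u≡c → <-irr (subst (l <±_) (trans u≡c (sym l≡c)) l<u)) (proj₂ fixed))) (proj₂ w∈)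
      unbounded (inj₂ u≡c) m = chain-lower (inj₁ (l<orbit m)) (descend u≡c m)
        where
        l<orbit = proj₂ (orbit-inside (σ-fixes l-outside
          (λ l≡c → <-irr (subst (l <±_) (trans u≡c (sym l≡c)) l<u)) (proj₁ fixed))) (proj₁ w∈)

    gap-evidence : ∀ e → Inside e → Evidence
    gap-evidence ⊥±    i = ⊥-elim (≮⊥ (proj₁ i))
    gap-evidence [ x ] i = find i
    gap-evidence ⊤±    i = ⊥-elim (⊤≮ (proj₂ i))

    gap-evidenceB : ∀ b → EB.Between (keep l) (keep u) b → Evidence
    gap-evidenceB ⊥± i = ⊥-elim (EB.≮⊥ (proj₁ i))
    gap-evidenceB ⊤± i = ⊥-elim (EB.⊤≮ (proj₂ i))
    gap-evidenceB [ new (late _ _ p) ] _ = p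
    gap-evidenceB [ out x x∉ ] (s , t) = ⊥-elim-irr (x∉
      ( keep-reflect l-outside (¬inside-recompute x∉) (subst (keep l EB.<±_) (sym (keep-out x x∉)) s)
      , keep-reflect (¬inside-recompute x∉) u-outside (subst (EB._<± keep u) (sym (keep-out x x∉)) t) ))

    new⇒evidence : ∀ i → [ new i ] EB.<± keep l → Evidence
    new⇒evidence (late _ _ p) _ = p

    -- Neither the gap of `A` nor that of `B` is known to be empty, but a point in either one is
    -- evidence, so `gap-fixed` applies with `Evidence` as its escape.
    dichotomy : Evidence ⊎ (Evidence → ∀ m → Chain m l u)
    dichotomy = Sum.map₂ (λ fixed p → Moved.unbounded p fixed endpoint)
      (Rigidity.gap-fixed sto EB.sto
        -- Transport along the identity merely changes the escape from `⊥` to `Evidence`.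
        (Transport.transport sto sto id (λ p _ → p) (λ z z<l → inj₂ (z , z<l , refl)) K)
        l<u gap-evidence
        (keep-Known new⇒evidence K) (keep-mono l-outside u-outside l<u) gap-evidenceB
        (map± fwd) (map± bwd) (map±-mono fwd-mono) (map±-mono bwd-mono)
        (map±-inverse fwd bwd strictlyInverseʳ) (map±-inverse bwd fwd strictlyInverseˡ))

-- Binary numerals as nodes of the infinite binary tree, ordered symmetrically: the
-- subtree 1+[2_] is to the left of the root zero, the subtree 2[1+_] to its right.
data _<T_ : ℕᵇ → ℕᵇ → Set where
  left-root  : ∀ {x}   → 1+[2 x ] <T zero
  root-right : ∀ {y}   → zero <T 2[1+ y ]
  left-right : ∀ {x y} → 1+[2 x ] <T 2[1+ y ]
  left       : ∀ {x y} → x <T y → 1+[2 x ] <T 1+[2 y ]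
  right      : ∀ {x y} → x <T y → 2[1+ x ] <T 2[1+ y ]

<T-trans : ∀ {x y z} → x <T y → y <T z → x <T z
<T-trans left-root  root-right = left-right
<T-trans root-right (right _)  = root-right
<T-trans left-right (right _)  = left-right
<T-trans (left _)   left-root  = left-root
<T-trans (left _)   left-right = left-right
<T-trans (left p)   (left q)   = left (<T-trans p q)
<T-trans (right p)  (right q)  = right (<T-trans p q)

<T-compare : ∀ x y → Tri (x <T y) (x ≡ y) (y <T x)
<T-compare zero     zero     = tri≈ (λ ()) refl (λ ())
<T-compare zero     2[1+ y ] = tri< root-right (λ ()) (λ ())
<T-compare zero     1+[2 y ] = tri> (λ ()) (λ ()) left-root
<T-compare 2[1+ x ] zero     = tri> (λ ()) (λ ()) root-right
<T-compare 2[1+ x ] 2[1+ y ] = tri-map (mk⇔ right λ { (right p) → p })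
  (mk⇔ (cong 2[1+_]) λ { refl → refl }) (mk⇔ right λ { (right p) → p }) (<T-compare x y)
<T-compare 2[1+ x ] 1+[2 y ] = tri> (λ ()) (λ ()) left-right
<T-compare 1+[2 x ] zero     = tri< left-root (λ ()) (λ ())
<T-compare 1+[2 x ] 2[1+ y ] = tri< left-right (λ ()) (λ ())
<T-compare 1+[2 x ] 1+[2 y ] = tri-map (mk⇔ left λ { (left p) → p })
  (mk⇔ (cong 1+[2_]) λ { refl → refl }) (mk⇔ left λ { (left p) → p }) (<T-compare x y)

<T-linear : IsStrictTotalOrder _≡_ _<T_
<T-linear = isStrictTotalOrderᶜ record
  { isEquivalence = isEquivalence ; trans = <T-trans ; compare = <T-compare }

<T-above : ∀ x → ∃[ z ] x <T z
<T-above zero     = 2[1+ zero ] , root-right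
<T-above 2[1+ x ] = let z , p = <T-above x in 2[1+ z ] , right p
<T-above 1+[2 x ] = zero , left-root

<T-below : ∀ x → ∃[ z ] z <T x
<T-below zero     = 1+[2 zero ] , left-root
<T-below 2[1+ x ] = zero , root-right
<T-below 1+[2 x ] = let z , p = <T-below x in 1+[2 z ] , left p

<T-dense : ∀ {x y} → x <T y → ∃[ z ] (x <T z × z <T y)
<T-dense (left-root {x})  = let z , p = <T-above x in 1+[2 z ] , left p , left-root
<T-dense (root-right {y}) = let z , p = <T-below y in 2[1+ z ] , root-right , right p
<T-dense left-right       = zero , left-root , root-right
<T-dense (left p)         = let z , q , r = <T-dense p in 1+[2 z ] , left q , left r
<T-dense (right p)        = let z , q , r = <T-dense p in 2[1+ z ] , right q , right r

-- Counting, positions in a chain, and finite partial isomorphisms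

count : ∀ {m} {P : Fin m → Set} → Decidable P → ℕ
count {zero}  P? = 0
count {suc m} P? with P? zero
... | yes _ = suc (count (P? ∘ suc))
... | no _  = count (P? ∘ suc)

count≤ : ∀ {m} {P : Fin m → Set} (P? : Decidable P) → count P? ℕ.≤ m
count≤ {zero}  P? = z≤n
count≤ {suc m} P? with P? zero
... | yes _ = s≤s (count≤ (P? ∘ suc))
... | no _  = ℕ.m≤n⇒m≤1+n (count≤ (P? ∘ suc))

count-⊆ : ∀ {m} {P Q : Fin m → Set} (P? : Decidable P) (Q? : Decidable Q) →
          (∀ i → P i → Q i) → count P? ℕ.≤ count Q?
count-⊆ {zero}  P? Q? P⊆Q = z≤n
count-⊆ {suc m} P? Q? P⊆Q with P? zero | Q? zero
... | yes _ | yes _ = s≤s (count-⊆ (P? ∘ suc) (Q? ∘ suc) (P⊆Q ∘ suc))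
... | yes p | no ¬q = ⊥-elim (¬q (P⊆Q zero p))
... | no _  | yes _ = ℕ.m≤n⇒m≤1+n (count-⊆ (P? ∘ suc) (Q? ∘ suc) (P⊆Q ∘ suc))
... | no _  | no _  = count-⊆ (P? ∘ suc) (Q? ∘ suc) (P⊆Q ∘ suc)

count-⊂ : ∀ {m} {P Q : Fin m → Set} (P? : Decidable P) (Q? : Decidable Q) →
          (∀ i → P i → Q i) → ∀ i → ¬ P i → Q i → count P? ℕ.< count Q?
count-⊂ {suc m} P? Q? P⊆Q i ¬p q with P? zero | Q? zero
count-⊂ P? Q? P⊆Q i       ¬p q | yes p | no ¬q = ⊥-elim (¬q (P⊆Q zero p))
count-⊂ P? Q? P⊆Q i       ¬p q | no _  | yes _ = s≤s (count-⊆ (P? ∘ suc) (Q? ∘ suc) (P⊆Q ∘ suc))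
count-⊂ P? Q? P⊆Q zero    ¬p q | yes p | yes _ = ⊥-elim (¬p p)
count-⊂ P? Q? P⊆Q (suc i) ¬p q | yes _ | yes _ = s≤s (count-⊂ (P? ∘ suc) (Q? ∘ suc) (P⊆Q ∘ suc) i ¬p q)
count-⊂ P? Q? P⊆Q zero    ¬p q | no _  | no ¬q = ⊥-elim (¬q q)
count-⊂ P? Q? P⊆Q (suc i) ¬p q | no _  | no _  = count-⊂ (P? ∘ suc) (Q? ∘ suc) (P⊆Q ∘ suc) i ¬p q

module ChainLookup {X : Set} {_<_ : X → X → Set} (sto : IsStrictTotalOrder _≡_ _<_) where
  open LinearOrder sto

  at : ∀ {m l u} → Chain m l u → ∀ i → i ℕ.< m → X
  at (cons x _ c) zero    _       = x
  at (cons x _ c) (suc i) (s≤s p) = at c i p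

  at-inside : ∀ {m l u} (c : Chain m l u) i (p : i ℕ.< m) → Between l u (at c i p)
  at-inside (cons x l<x c) zero    _       = l<x , chain-< c
  at-inside (cons x l<x c) (suc i) (s≤s p) = let q , r = at-inside c i p in <-trans l<x q , r

  at-mono : ∀ {m l u} (c : Chain m l u) {i j} (p : i ℕ.< m) (q : j ℕ.< m) → i ℕ.< j → at c i p < at c j q
  at-mono (cons x l<x c) {zero}  {suc j} _       (s≤s q) _         = proj₁ (at-inside c j q)
  at-mono (cons x l<x c) {suc i} {suc j} (s≤s p) (s≤s q) (s≤s i<j) = at-mono c p q i<j

module PartialIso {A B : Structure} (linA : IsLinearOrdering A) (linB : IsLinearOrdering B) where
  private
    module A = Ends A linA
    module B = Ends B linB

  Pair : Set
  Pair = Carrier A ± × Carrier B ±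

  -- One direction is enough for a list of pairs: trichotomy supplies the other, see `good-reflect`.
  Sim : Pair → Pair → Set
  Sim (x , x') (y , y') = (x A.<± y → x' B.<± y') × (x ≡ y → x' ≡ y')

  Good : List Pair → Set
  Good L = ∀ {p q} → p ∈ L → q ∈ L → Sim p q

  good-≤ : ∀ {L p q} → Good L → p ∈ L → q ∈ L → proj₁ p A.≤ proj₁ q → proj₂ p B.≤ proj₂ q
  good-≤ good p q (inj₁ lt) = inj₁ (proj₁ (good p q) lt)
  good-≤ good p q (inj₂ e)  = inj₂ (proj₂ (good p q) e)

  good-reflect : ∀ {L} → Good L → ∀ {x x' y y'} → (x , x') ∈ L → (y , y') ∈ L →
                 (x' B.<± y' → x A.<± y) × (x' ≡ y' → x ≡ y)
  good-reflect good {x} {x'} {y} {y'} p q with A.compare x y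
  ... | tri< x<y _ _  = (λ _ → x<y) ,
    λ { refl → ⊥-elim (B.<-irr (proj₁ (good p q) x<y)) }
  ... | tri≈ _ refl _ = (λ lt → ⊥-elim (B.<-irr (subst (x' B.<±_) (sym (proj₂ (good p q) refl)) lt))) , λ _ → refl
  ... | tri> _ _ y<x  = (λ lt → ⊥-elim (B.asym lt (proj₁ (good q p) y<x))) ,
    λ { refl → ⊥-elim (B.<-irr (proj₁ (good q p) y<x)) }

  record Neighbours (L : List Pair) (a : Carrier A ±) : Set where
    constructor neighbours
    field
      {l u}  : Carrier A ±
      {l' u'} : Carrier B ±
      l∈     : (l , l') ∈ L
      u∈     : (u , u') ∈ L
      l<a    : l A.<± a
      a<u    : a A.<± u
      apart  : ∀ {p} → p ∈ L → proj₁ p A.≤ l ⊎ u A.≤ proj₁ p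

  locate : ∀ L {lo lo' hi hi'} a → (lo , lo') ∈ L → (hi , hi') ∈ L → lo A.<± a → a A.<± hi →
           (∃[ b ] (a , b) ∈ L) ⊎ Neighbours L a
  locate L {lo} {lo'} {hi} {hi'} a lo∈ hi∈ lo<a a<hi = Sum.map₂ finish (go L id)
    where
    Partial : List Pair → Set
    Partial K = ∃[ l ] ∃[ l' ] ∃[ u ] ∃[ u' ] ((l , l') ∈ L × (u , u') ∈ L × A.Between l u a ×
      ∀ {p} → p ∈ K → proj₁ p A.≤ l ⊎ u A.≤ proj₁ p)

    finish : Partial L → Neighbours L a
    finish (_ , _ , _ , _ , l∈ , u∈ , (l<a , a<u) , apart) = neighbours l∈ u∈ l<a a<u apart

    go : ∀ K → (∀ {p} → p ∈ K → p ∈ L) → (∃[ b ] (a , b) ∈ L) ⊎ Partial K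
    go [] K⊆L = inj₂ (lo , lo' , hi , hi' , lo∈ , hi∈ , (lo<a , a<hi) , λ ())
    go ((x , x') ∷ K) K⊆L with go K (K⊆L ∘ there) | A.compare x a
    ... | inj₁ found | _ = inj₁ found
    ... | inj₂ _     | tri≈ _ refl _ = inj₁ (x' , K⊆L (here refl))
    ... | inj₂ (l , l' , u , u' , l∈ , u∈ , (l<a , a<u) , apart) | tri< x<a _ _ with A.<-or-≥ l x
    ...   | inj₂ x≤l = inj₂ (l , l' , u , u' , l∈ , u∈ , (l<a , a<u) ,
              λ { (here refl) → inj₁ x≤l ; (there p) → apart p })
    ...   | inj₁ l<x = inj₂ (x , x' , u , u' , K⊆L (here refl) , u∈ , (x<a , a<u) ,
              λ { (here refl) → inj₁ A.≤-refl
                ; (there p) → Sum.map₁ (λ q → A.≤-trans q (inj₁ l<x)) (apart p) })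
    go ((x , x') ∷ K) K⊆L | inj₂ (l , l' , u , u' , l∈ , u∈ , (l<a , a<u) , apart) | tri> _ _ a<x with A.<-or-≥ x u
    ...   | inj₂ u≤x = inj₂ (l , l' , u , u' , l∈ , u∈ , (l<a , a<u) ,
              λ { (here refl) → inj₂ u≤x ; (there p) → apart p })
    ...   | inj₁ x<u = inj₂ (l , l' , x , x' , l∈ , K⊆L (here refl) , (l<a , a<x) ,
              λ { (here refl) → inj₂ A.≤-refl
                ; (there p) → Sum.map₂ (λ q → A.≤-trans (inj₁ x<u) q) (apart p) })

  sim-refl : ∀ {p} → Sim p p
  sim-refl = (λ p → ⊥-elim (A.<-irr p)) , λ _ → refl

  good-cons : ∀ {L p} → Good L → (∀ {q} → q ∈ L → Sim p q × Sim q p) → Good (p ∷ L)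
  good-cons good sim (here refl) (here refl) = sim-refl
  good-cons good sim (here refl) (there q)   = proj₁ (sim q)
  good-cons good sim (there p)   (here refl) = proj₂ (sim p)
  good-cons good sim (there p)   (there q)   = good p q

  good-insert : ∀ {L a b} → Good L → (nb : Neighbours L a) → let open Neighbours nb in
                l' B.<± b → b B.<± u' → Good ((a , b) ∷ L)
  good-insert {L} {a} {b} good (neighbours l∈ u∈ l<a a<u apart) l'<b b<u' = good-cons good sim
    where
    sim : ∀ {q} → q ∈ L → Sim (a , b) q × Sim q (a , b)
    sim {x , x'} q∈ with apart q∈
    ... | inj₁ x≤l =
      ( (λ a<x → ⊥-elim (A.<⇒≱ (A.<-trans l<a a<x) x≤l))
      , (λ { refl → ⊥-elim (A.<⇒≱ l<a x≤l) }) ) ,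
      ( (λ _ → B.≤-<-trans (good-≤ good q∈ l∈ x≤l) l'<b)
      , (λ { refl → ⊥-elim (A.<⇒≱ l<a x≤l) }) )
    ... | inj₂ u≤x =
      ( (λ _ → B.<-≤-trans b<u' (good-≤ good u∈ q∈ u≤x))
      , (λ { refl → ⊥-elim (A.<⇒≱ a<u u≤x) }) ) ,
      ( (λ x<a → ⊥-elim (A.<⇒≱ (A.<-trans x<a a<u) u≤x))
      , (λ { refl → ⊥-elim (A.<⇒≱ a<u u≤x) }) )

  Linked : ∀ {m} → List Pair → (Fin m → Carrier A) → (Fin m → Carrier B) → Set
  Linked L ρ ρ' = ∀ i → ([ ρ i ] , [ ρ' i ]) ∈ L

  linked-extend : ∀ {m L} {ρ : Fin m → Carrier A} {ρ'} {a b} → ([ a ] , [ b ]) ∈ L → Linked L ρ ρ' →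
                  Linked L (extend a ρ) (extend b ρ')
  linked-extend e r zero    = e
  linked-extend e r (suc i) = r i

  module _ {m L} {ρ : Fin m → Carrier A} {ρ'} (good : Good L) (r : Linked L ρ ρ') where

    linked-rel : ∀ i j → _≺_ A (ρ i) (ρ j) ⇔ _≺_ B (ρ' i) (ρ' j)
    linked-rel i j = mk⇔ (λ p → B.lower (proj₁ (good (r i) (r j)) (A.lift p)))
                         (λ p → A.lower (proj₁ (good-reflect good (r i) (r j)) (B.lift p)))

    linked-eq : ∀ i j → ρ i ≡ ρ j ⇔ ρ' i ≡ ρ' j
    linked-eq i j = mk⇔ (λ e → [_]-injective (proj₂ (good (r i) (r j)) (cong [_] e)))
                        (λ e → [_]-injective (proj₂ (good-reflect good (r i) (r j)) (cong [_] e)))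

-- The new copy of the rationals preserves the theory: its finite subsets embed into the old
-- gap, and it absorbs all witnesses found there.
module Densify {n} {θ : ℕ → Formula n} (univ : ∀ i → AllSig 1 (θ i)) (M : Model θ)
  (enumerated : Enumerated (Model.str M))
  {l u : Carrier (Model.str M) ±} (l<u : Ends._<±_ (Model.str M) (Model.linear M) l u)
  (chains : ∀ m → Ends.Chain (Model.str M) (Model.linear M) m l u)
  (params-outside : ∀ j → ¬ Splice.Inside (Model.str M) (Model.linear M) l u [ Model.param M j ]) where

  open Model M renaming (str to A)
  open Ends A linear
  open Splice A linear l u
  private
    module A = IsStrictTotalOrder linear

  Elt : Set
  Elt = Spliced ℕᵇ

  -- A kept point below `u` is at or below `l`, and one above `l` is at or above `u`. The mixed
  -- clauses thus say on which side of the gap the kept point lies.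
  _<D_ : Elt → Elt → Set
  out x _ <D out y _ = _≺_ A x y
  out x _ <D new _   = [ x ] <± u
  new _   <D out y _ = l <± [ y ]
  new q   <D new r   = q <T r

  <D-trans : ∀ {b₁ b₂ b₃} → b₁ <D b₂ → b₂ <D b₃ → b₁ <D b₃
  <D-trans {out _ _}  {out _ _}  {out _ _}  p q = A.trans p q
  <D-trans {out _ _}  {out _ _}  {new _}    p q = <-trans (lift p) q
  <D-trans {out x x∉} {new _}    {out _ _}  p q with outside (¬inside-recompute x∉)
  ... | inj₁ x≤l = lower (≤-<-trans x≤l q)
  ... | inj₂ u≤x = ⊥-elim (<⇒≱ p u≤x)
  <D-trans {out _ _}  {new _}    {new _}    p q = p
  <D-trans {new _}    {out _ _}  {out _ _}  p q = <-trans p (lift q)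
  <D-trans {new _}    {out x x∉} {new _}    p q = ⊥-elim-irr (x∉ (p , q))
  <D-trans {new _}    {new _}    {out _ _}  p q = q
  <D-trans {new _}    {new _}    {new _}    p q = <T-trans p q

  <D-compare : ∀ b b' → Tri (b <D b') (b ≡ b') (b' <D b)
  <D-compare (out x _) (out y _) = tri-map (mk⇔ id id) out-≡ (mk⇔ id id) (A.compare x y)
  <D-compare (out x x∉) (new _) with outside (¬inside-recompute x∉)
  ... | inj₁ x≤l = tri< (≤-<-trans x≤l l<u) (λ ()) (λ l<x → <⇒≱ l<x x≤l)
  ... | inj₂ u≤x = tri> (λ x<u → <⇒≱ x<u u≤x) (λ ()) (<-≤-trans l<u u≤x)
  <D-compare (new _) (out x x∉) with outside (¬inside-recompute x∉)
  ... | inj₁ x≤l = tri> (λ l<x → <⇒≱ l<x x≤l) (λ ()) (≤-<-trans x≤l l<u)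
  ... | inj₂ u≤x = tri< (<-≤-trans l<u u≤x) (λ ()) (λ x<u → <⇒≱ x<u u≤x)
  <D-compare (new q) (new r) = tri-map (mk⇔ id id) (mk⇔ (cong new) λ { refl → refl }) (mk⇔ id id)
    (<T-compare q r)

  code : Elt → ℕᵇ
  code (out x _) = 2[1+ fromℕ (enc A x) ]
  code (new q)   = 1+[2 q ]

  code-injective : ∀ {b b'} → code b ≡ code b' → b ≡ b'
  code-injective {out x _} {out y _} e = to out-≡ (enc-inj A (fromℕ-injective (2[1+_]-injective e)))
  code-injective {new q}   {new r}   e = cong new (1+[2_]-injective e)

  D : Structure
  D = record
    { Carrier = Elt
    ; _≺_     = _<D_
    ; enc     = toℕ ∘ code
    ; enc-inj = code-injective ∘ toℕ-injective
    }

  D-linear : IsLinearOrdering D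
  D-linear = isStrictTotalOrderᶜ record
    { isEquivalence = isEquivalence
    ; trans         = λ {b₁} {b₂} {b₃} → <D-trans {b₁} {b₂} {b₃}
    ; compare       = <D-compare
    }

  D-enumerated : Enumerated D
  D-enumerated = (λ k → new (fromℕ k) ∷ concatMap retain (proj₁ enumerated k)) , exhaust
    where
    retain : Carrier A → List Elt
    retain x with inside? [ x ]
    ... | yes _ = []
    ... | no ¬i = out x ¬i ∷ []

    ∈-retain : ∀ x .(x∉ : ¬ Inside [ x ]) → out x x∉ ∈ retain x
    ∈-retain x x∉ with inside? [ x ]
    ... | yes i = ⊥-elim-irr (x∉ i)
    ... | no _  = here refl

    exhaust : ∀ b → ∃[ k ] b ∈ new (fromℕ k) ∷ concatMap retain (proj₁ enumerated k)
    exhaust (new q)    = toℕ q , here (cong new (sym (fromℕ-toℕ q)))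
    exhaust (out x x∉) = let k , x∈ = proj₂ enumerated x in
      k , there (∈-concatMap⁺ retain (lose x∈ (∈-retain x x∉)))

  module D = Ends D D-linear
  open Order _<D_ D-linear (mk⇔ id id) public

  keep-<-new : ∀ {e q} → ¬ Inside e → e <± u → keep e D.<± [ new q ]
  keep-<-new {⊥±}    _  _ = ⊥±<[ _ ]
  keep-<-new {⊤±}    _  p = ⊥-elim (⊤≮ p)
  keep-<-new {[ x ]} x∉ p = subst (D._<± _) (sym (keep-out x x∉)) (D.lift p)

  new-<-keep : ∀ {e q} → ¬ Inside e → l <± e → [ new q ] D.<± keep e
  new-<-keep {⊥±}    _  p = ⊥-elim (≮⊥ p)
  new-<-keep {⊤±}    _  _ = [ _ ]<⊤±
  new-<-keep {[ x ]} x∉ p = subst (_ D.<±_) (sym (keep-out x x∉)) (D.lift p)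

  inner : ∀ {z} → keep l D.<± z → z D.<± keep u → ∃[ q ] z ≡ [ new q ]
  inner {⊥±} p _ = ⊥-elim (D.≮⊥ p)
  inner {⊤±} _ p = ⊥-elim (D.⊤≮ p)
  inner {[ new q ]} _ _ = q , refl
  inner {[ out x x∉ ]} p q = ⊥-elim-irr (x∉
    ( keep-reflect l-outside (¬inside-recompute x∉) (subst (keep l D.<±_) (sym (keep-out x x∉)) p)
    , keep-reflect (¬inside-recompute x∉) u-outside (subst (D._<± keep u) (sym (keep-out x x∉)) q) ))

  fill : ∀ {x y} → keep l D.≤ x → x D.<± y → y D.≤ keep u → ∃ (D.Between x y)
  fill {x} {y} l≤x x<y y≤u = go (bound l≤x (D.<-≤-trans x<y y≤u)) (bound' (D.≤-<-trans l≤x x<y) y≤u)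
    where
    bound : keep l D.≤ x → x D.<± keep u → (∃[ q ] x ≡ [ new q ]) ⊎ keep l ≡ x
    bound (inj₁ p)    q = inj₁ (inner p q)
    bound (inj₂ refl) _ = inj₂ refl

    bound' : keep l D.<± y → y D.≤ keep u → (∃[ q ] y ≡ [ new q ]) ⊎ y ≡ keep u
    bound' p (inj₁ q)    = inj₁ (inner p q)
    bound' _ (inj₂ refl) = inj₂ refl

    go : (∃[ q ] x ≡ [ new q ]) ⊎ keep l ≡ x → (∃[ q ] y ≡ [ new q ]) ⊎ y ≡ keep u → ∃ (D.Between x y)
    go (inj₂ refl) (inj₂ refl) = [ new zero ] , keep-<-new l-outside l<u , new-<-keep u-outside l<u
    go (inj₁ (q , refl)) (inj₂ refl) = let r , q<r = <T-above q in
      [ new r ] , D.lift q<r , new-<-keep u-outside l<u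
    go (inj₂ refl) (inj₁ (r , refl)) = let q , q<r = <T-below r in
      [ new q ] , keep-<-new l-outside l<u , D.lift q<r
    go (inj₁ (q , refl)) (inj₁ (r , refl)) = let s , q<s , s<r = <T-dense (D.lower x<y) in
      [ new s ] , D.lift q<s , D.lift s<r

  open PartialIso {A} {D} linear D-linear

  -- Outside the gap the partner is forced, so comparisons need attention only when both points are
  -- inside.
  Typed : Pair → Set
  Typed (e , e') = (¬ Inside e × e' ≡ keep e) ⊎ (Inside e × ∃[ q ] e' ≡ [ new q ])

  typed-sim : ∀ {p q} → Typed p → Typed q → (Inside (proj₁ p) → Inside (proj₁ q) → Sim p q) → Sim p q
  typed-sim (inj₁ (e∉ , refl)) (inj₁ (f∉ , refl)) _ = keep-mono e∉ f∉ , cong keep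
  typed-sim (inj₁ (e∉ , refl)) (inj₂ (f∈ , _ , refl)) _ =
    (λ e<f → keep-<-new e∉ (<-trans e<f (proj₂ f∈))) , λ { refl → ⊥-elim (e∉ f∈) }
  typed-sim (inj₂ (e∈ , _ , refl)) (inj₁ (f∉ , refl)) _ =
    (λ e<f → new-<-keep f∉ (<-trans (proj₁ e∈) e<f)) , λ { refl → ⊥-elim (f∉ e∈) }
  typed-sim (inj₂ (e∈ , _)) (inj₂ (f∈ , _)) sim = sim e∈ f∈

  Rel : ∀ {m} → (Fin m → Carrier A) → (Fin m → Elt) → Set
  Rel ρ ρ' = Σ[ L ∈ List Pair ] Good L × All Typed L × (l , keep l) ∈ L × (u , keep u) ∈ L × Linked L ρ ρ'

  forth : ∀ {m} {ρ : Fin m → Carrier A} {ρ'} → Rel ρ ρ' → ∀ a → ⊥ ⊎ ∃[ b ] Rel (extend a ρ) (extend b ρ')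
  forth (L , good , typed , l∈ , u∈ , r) a with inside? [ a ]
  ... | no a∉ = inj₂ (out a a∉ , ([ a ] , [ out a a∉ ]) ∷ L
    , good-cons good (λ q∈ → let t' = All.lookup typed q∈ in
        typed-sim t t' (λ a∈ → ⊥-elim (a∉ a∈)) , typed-sim t' t (λ _ a∈ → ⊥-elim (a∉ a∈)))
    , t ∷ typed , there l∈ , there u∈ , linked-extend (here refl) (there ∘ r))
    where
    t : Typed ([ a ] , [ out a a∉ ])
    t = inj₁ (a∉ , sym (keep-out a a∉))
  ... | yes a∈ with locate L [ a ] l∈ u∈ (proj₁ a∈) (proj₂ a∈)
  ...   | inj₁ (b , ab∈) with All.lookup typed ab∈
  ...     | inj₁ (a∉ , _) = ⊥-elim (a∉ a∈)
  ...     | inj₂ (_ , q , refl) = inj₂ (new q , L , good , typed , l∈ , u∈ , linked-extend ab∈ r)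
  forth (L , good , typed , l∈ , u∈ , r) a | yes a∈ | inj₂ nb@(neighbours x∈ y∈ x<a a<y apart)
    = inj₂ (absorb (fill l'≤x (proj₁ (good x∈ y∈) (<-trans x<a a<y)) y≤u'))
    where
    l'≤x : keep l D.≤ Neighbours.l' nb
    l'≤x = good-≤ good l∈ x∈ (Sum.[ id , (λ y≤l → ⊥-elim (<⇒≱ (<-trans (proj₁ a∈) a<y) y≤l)) ] (apart l∈))

    y≤u' : Neighbours.u' nb D.≤ keep u
    y≤u' = good-≤ good y∈ u∈ (Sum.[ (λ u≤x → ⊥-elim (<⇒≱ (<-trans x<a (proj₂ a∈)) u≤x)) , id ] (apart u∈))

    absorb : ∃ (D.Between (Neighbours.l' nb) (Neighbours.u' nb)) → ∃[ b ] Rel (extend a _) (extend b _)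
    absorb (z , x<z , z<y) with inner (D.≤-<-trans l'≤x x<z) (D.<-≤-trans z<y y≤u')
    ... | q , refl = new q , _ ∷ L , good-insert good nb x<z z<y , inj₂ (a∈ , q , refl) ∷ typed
      , there l∈ , there u∈ , linked-extend (here refl) (there ∘ r)

  open ChainLookup sto

  -- Only the relative order of the new points in the tuple matters. A numeral is sent to the chain
  -- element whose position is the number of tuple entries below it.
  module Embed {m} (ρ' : Fin m → Elt) where

    Below : ℕᵇ → Fin m → Set
    Below q i = ∃[ r ] (ρ' i ≡ new r × r <T q)

    below? : ∀ q → Decidable (Below q)
    below? q i with ρ' i
    ... | out _ _ = no λ { (_ , () , _) }
    ... | new r with IsStrictTotalOrder._<?_ <T-linear r q
    ...   | yes p = yes (r , refl , p)
    ...   | no ¬p = no λ { (_ , refl , p) → ¬p p }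

    rank : ℕᵇ → ℕ
    rank q = count (below? q)

    rank< : ∀ q → rank q ℕ.< suc m
    rank< q = s≤s (count≤ (below? q))

    rank-mono : ∀ {q r} i → ρ' i ≡ new q → q <T r → rank q ℕ.< rank r
    rank-mono {q} {r} i e q<r = count-⊂ (below? q) (below? r)
      (λ _ (s , e' , s<q) → s , e' , <T-trans s<q q<r) i
      (λ (s , e' , s<q) → irr (trans (sym e) e') s<q) (q , e , q<r)
      where
      irr : ∀ {s} → new q ≡ new {ℕᵇ} s → ¬ (s <T q)
      irr refl = IsStrictTotalOrder.irrefl <T-linear refl

    slot : ℕᵇ → Carrier A ±
    -- A rank can be any number from 0 to `m`, which takes `suc m` positions.
    slot q = at (chains (suc m)) (rank q) (rank< q)

    slot-inside : ∀ q → Inside (slot q)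
    slot-inside q = at-inside (chains (suc m)) (rank q) (rank< q)

    pull : Elt → Carrier A
    pull (out x _) = x
    pull (new q)   = proj₁ (point (slot-inside q))

    pull-new : ∀ q → slot q ≡ [ pull (new q) ]
    pull-new q = proj₂ (point (slot-inside q))

    typed : ∀ b → Typed ([ pull b ] , [ b ])
    typed (out x x∉) = inj₁ (¬inside-recompute x∉ , sym (keep-out x x∉))
    typed (new q)    = inj₂ (subst Inside (pull-new q) (slot-inside q) , q , refl)

    inner-sim : ∀ i j → Inside [ pull (ρ' i) ] → Inside [ pull (ρ' j) ] →
                Sim ([ pull (ρ' i) ] , [ ρ' i ]) ([ pull (ρ' j) ] , [ ρ' j ])
    inner-sim i j with ρ' i in eqi | ρ' j in eqj
    ... | out x x∉ | _        = λ x∈ _ → ⊥-elim-irr (x∉ x∈)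
    ... | new _    | out y y∉ = λ _ y∈ → ⊥-elim-irr (y∉ y∈)
    ... | new q    | new r    = λ _ _ → go (<T-compare q r)
      where
      slot-mono : ∀ {q r} i → ρ' i ≡ new q → q <T r → [ pull (new q) ] <± [ pull (new r) ]
      slot-mono {q} {r} i e q<r = subst₂ _<±_ (pull-new q) (pull-new r)
        (at-mono (chains (suc m)) (rank< q) (rank< r) (rank-mono i e q<r))

      go : Tri (q <T r) (q ≡ r) (r <T q) → Sim ([ pull (new q) ] , [ new q ]) ([ pull (new r) ] , [ new r ])
      go (tri< q<r _ _)  = (λ _ → D.lift q<r) ,
        λ e → ⊥-elim (<-irr (subst ([ pull (new q) ] <±_) (sym e) (slot-mono i eqi q<r)))
      go (tri≈ _ refl _) = sim-refl
      go (tri> _ _ r<q)  = (λ p → ⊥-elim (asym p (slot-mono j eqj r<q))) ,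
        λ e → ⊥-elim (<-irr (subst ([ pull (new r) ] <±_) e (slot-mono j eqj r<q)))

    pairs : List Pair
    pairs = (l , keep l) ∷ (u , keep u) ∷ tabulate λ i → [ pull (ρ' i) ] , [ ρ' i ]

    all-typed : All Typed pairs
    all-typed = inj₁ (l-outside , refl) ∷ inj₁ (u-outside , refl) ∷ All.tabulate λ p∈ →
      let i , e = ∈-tabulate⁻ p∈ in subst Typed (sym e) (typed (ρ' i))

    inside-index : ∀ {p} → p ∈ pairs → Inside (proj₁ p) → ∃[ i ] p ≡ ([ pull (ρ' i) ] , [ ρ' i ])
    inside-index (here refl)         i = ⊥-elim (l-outside i)
    inside-index (there (here refl)) i = ⊥-elim (u-outside i)
    inside-index (there (there p∈))  _ = ∈-tabulate⁻ p∈

    good : Good pairs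
    good p∈ q∈ = typed-sim (All.lookup all-typed p∈) (All.lookup all-typed q∈)
      λ p-in q-in → both (inside-index p∈ p-in) (inside-index q∈ q-in) p-in q-in
      where
      both : ∀ {p q} → ∃[ i ] p ≡ ([ pull (ρ' i) ] , [ ρ' i ]) → ∃[ j ] q ≡ ([ pull (ρ' j) ] , [ ρ' j ]) →
             Inside (proj₁ p) → Inside (proj₁ q) → Sim p q
      both (i , refl) (j , refl) = inner-sim i j

    pull-rel : Rel (pull ∘ ρ') ρ'
    pull-rel = pairs , good , all-typed , here refl , there (here refl) ,
      λ i → there (there (∈-tabulate⁺ {f = λ i → [ pull (ρ' i) ] , [ ρ' i ]} i))

  paramD : Fin n → Elt
  paramD j = out (param j) (params-outside j)

  open Forth {A} {D} {⊥} Rel (λ (_ , good , _ , _ , _ , r) → linked-rel good r)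
    (λ (_ , good , _ , _ , _ , r) → linked-eq good r) forth

  D-reflects : ∀ k {d} {τ : Formula (k ℕ.+ n)} → d ℕ.≤ 1 → Sig d τ →
    (∀ ρ → Agree A param k ρ → Sat A ρ τ) → ∀ ρ' → Agree D paramD k ρ' → Sat D ρ' τ
  D-reflects k d≤1 s pf ρ' ag = Sum.[ ⊥-elim , id ]
    (Sig-transfer d≤1 s pull-rel (pf (pull ∘ ρ') (cong pull ∘ ag)))
    where open Embed ρ'

  densified : Model θ
  densified = record
    { str    = D
    ; linear = D-linear
    ; param  = paramD
    ; sat    = theory-transfer D-reflects univ sat
    }

  new≮keep-l : ∀ q → [ new q ] D.<± keep l → ⊥
  new≮keep-l q p = D.asym p (keep-<-new l-outside l<u)

  densified-Known : ∀ {k} → Known ⊥ k l → D.Known ⊥ k (keep u)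
  densified-Known K = D.dense (keep-Known new≮keep-l K) (keep-mono l-outside u-outside l<u)
    λ _ _ l≤x x<y y≤u → inj₂ (fill l≤x x<y y≤u)

  densified-Mem : ∀ {k} (K : Known ⊥ k l) {e} → Mem e K → D.Mem (keep e) (densified-Known K)
  densified-Mem K e∈ = inj₁ (keep-Mem new≮keep-l K e∈)

-- Resolving all gaps between the parameters

module ChainMembership {X : Set} {_<_ : X → X → Set} (sto : IsStrictTotalOrder _≡_ _<_) where
  open LinearOrder sto

  InChain : ∀ {m l u} → X → Chain m l u → Set
  InChain e (nil _)      = ⊥
  InChain e (cons x _ c) = e ≡ x ⊎ InChain e c

  inChain⇒< : ∀ {m l u e} (c : Chain m l u) → InChain e c → l < e
  inChain⇒< (cons x l<x c) (inj₁ refl) = l<x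
  inChain⇒< (cons x l<x c) (inj₂ e∈)   = <-trans l<x (inChain⇒< c e∈)

  insert : ∀ {m l u x} → l < x → x < u → (c : Chain m l u) →
           ∃[ m' ] Σ[ c' ∈ Chain m' l u ] (InChain x c' × (∀ {e} → InChain e c → InChain e c'))
  insert {x = x} l<x x<u (nil _) = _ , cons x l<x (nil x<u) , inj₁ refl , λ ()
  insert {x = x} l<x x<u (cons y l<y c) with compare x y
  ... | tri< x<y _ _  = _ , cons x l<x (cons y x<y c) , inj₁ refl , inj₂
  ... | tri≈ _ refl _ = _ , cons y l<y c , inj₁ refl , id
  ... | tri> _ _ y<x  = let _ , c' , x∈ , sub = insert y<x x<u c in
    _ , cons y l<y c' , inj₂ x∈ , Sum.map₂ sub

  -- Sorts the parameters; coinciding ones are merged, so `m` may be smaller than `n`.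
  collect : ∀ {l u} → l < u → ∀ {n} (f : Fin n → X) → (∀ j → Between l u (f j)) →
            ∃[ m ] Σ[ c ∈ Chain m l u ] (∀ j → InChain (f j) c)
  collect l<u {zero}  f f∈ = 0 , nil l<u , λ ()
  collect l<u {suc n} f f∈ =
    let _ , c  , all      = collect l<u (f ∘ suc) (f∈ ∘ suc)
        m , c' , x∈ , sub = insert (proj₁ (f∈ zero)) (proj₂ (f∈ zero)) c
    in m , c' , λ { zero → x∈ ; (suc j) → sub (all j) }

module Resolve {n} {θ : ℕ → Formula n} (univ : ∀ i → AllSig 1 (θ i))
  (categorical : (M N : Model θ) → Model.str M ≅ Model.str N) where

  module Gap (M : Model θ) (enumerated : Enumerated (Model.str M))
    {l u : Carrier (Model.str M) ±} (l<u : Ends._<±_ (Model.str M) (Model.linear M) l u)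
    (apart : ∀ j → Ends._≤_ (Model.str M) (Model.linear M) [ Model.param M j ] l ⊎
                   Ends._≤_ (Model.str M) (Model.linear M) u [ Model.param M j ])
    (bounded : ¬ (∀ m → Ends.Chain (Model.str M) (Model.linear M) m l u)) where

    open Model M renaming (str to A)
    open Ends A linear

    Extension : ∀ {k b} → Known ⊥ k b → Set
    Extension K = ∃[ k' ] Σ[ K' ∈ Known ⊥ k' u ] (∀ {e} → Mem e K → Mem e K')

    no-param : ∀ {e} → Between l u e → ∀ j → [ param j ] ≢ e
    no-param (l<e , e<u) j refl with apart j
    ... | inj₁ p≤l = <⇒≱ l<e p≤l
    ... | inj₂ u≤p = <⇒≱ e<u u≤p

    -- As `c` lies strictly inside a gap without parameters, trading it moves no parameter and the
    -- adversary is a model. If its isomorphism yields no point, then any point of the subgap would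
    -- produce chains of all lengths, which `bounded` forbids; so the subgap is empty.
    resolve-gap : ∀ {k l' u'} → Known ⊥ k l' → l' <± u' → l ≤ l' → u' ≤ u →
                  ∀ c → Between l u [ c ] → l' ≡ [ c ] ⊎ u' ≡ [ c ] →
                  ∃ (Between l' u') ⊎ (∀ z → Between l' u' z → ⊥)
    resolve-gap {l' = l'} {u'} K l'<u' l≤l' u'≤u c c-in endpoint = Sum.map
      (λ p → [ _ ] , proj₂ (found p))
      (λ unbounded z z∈ → bounded λ m → chain-lower l≤l' (chain-upper u'≤u
        (unbounded (gap-evidence K h z z∈) m)))
      (dichotomy K h)
      where
      open Adversary univ M enumerated l'<u' c endpoint
        (λ j (l'<p , p<u') → no-param (≤-<-trans l≤l' l'<p , <-≤-trans p<u' u'≤u) j refl)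
        (λ j p≡c → no-param c-in j (cong [_] p≡c))
      h = categorical M adversary

    mutual
      -- Goes along the chain from the left, since `resolve-gap` needs everything below a subgap
      -- decomposed. Either some subgap yields a further point, or all are empty and the chain
      -- exhausts the gap. The last subgap trades its lower endpoint, the others their upper one, as
      -- `l` and `u` may be parameters or infinite.
      scan : ∀ {m k l'} → Chain m l' u → (K : Known ⊥ k l') → Between l u l' →
             Chain (suc m) l' u ⊎ Extension K
      scan (nil l'<u) K l'-in with point l'-in
      ... | c , refl with resolve-gap K l'<u (inj₁ (proj₁ l'-in)) ≤-refl c l'-in (inj₁ refl)
      ...   | inj₁ (z , l'<z , z<u) = inj₁ (cons z l'<z (nil z<u))
      ...   | inj₂ e = inj₂ (_ , empty K l'<u e , inj₁)
      scan (cons x l'<x c) K l'-in = scan-cons x l'<x c K (inj₁ (proj₁ l'-in))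

      scan-cons : ∀ {m k l'} x → l' <± x → Chain m x u → (K : Known ⊥ k l') → l ≤ l' →
                  Chain (suc (suc m)) l' u ⊎ Extension K
      scan-cons x l'<x c K l≤l' with point (≤-<-trans l≤l' l'<x , chain-< c)
      ... | y , refl
        with resolve-gap K l'<x l≤l' (inj₁ (chain-< c)) y (≤-<-trans l≤l' l'<x , chain-< c) (inj₂ refl)
      ...   | inj₁ (z , l'<z , z<x) = inj₁ (cons z l'<z (cons [ y ] z<x c))
      ...   | inj₂ e with scan c (empty K l'<x e) (≤-<-trans l≤l' l'<x , chain-< c)
      ...     | inj₁ c'            = inj₁ (cons [ y ] l'<x c')
      ...     | inj₂ (_ , K' , sub) = inj₂ (_ , K' , sub ∘ inj₁)

    -- If no finite chain exhausts the gap, a single point of it can be extended to chains of every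
    -- length, against `bounded`. So the gap has no point at all, and this too is a finite
    -- decomposition.
    not-finite⇒⊥ : ∀ {k} (K : Known ⊥ k l) → ¬ Extension K → ⊥
    not-finite⇒⊥ K infinite = infinite (_ , empty K l<u (λ z z∈ → bounded (unbounded z∈)) , inj₁)
      where
      unbounded : ∀ {z} → Between l u z → ∀ m → Chain m l u
      unbounded (l<z , z<u) zero          = nil l<u
      -- A trade needs a point strictly inside the gap, so the recursion can take over only once `z`
      -- is in the chain.
      unbounded (l<z , z<u) (suc zero)    = cons _ l<z (nil z<u)
      unbounded z∈          (suc (suc m)) with unbounded z∈ (suc m)
      ... | cons x l<x c with scan-cons x l<x c K ≤-refl
      ...   | inj₁ c'  = c'
      ...   | inj₂ ext = ⊥-elim (infinite ext)

  Resolved : Set₁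
  Resolved = Σ[ M ∈ Model θ ]
    let open Model M
        open Ends str linear
    in ∃[ k ] Σ[ K ∈ Known ⊥ k ⊤± ] (∀ j → Mem [ param j ] K)

  -- The goal is absurd, so nothing has to decide whether the next gap is finite: both continuations
  -- are refuted, one extending `K` in the same model, the other passing to the densified model. The
  -- recursion is on the number `r` of parameters still ahead, for a varying model.
  advance : ¬ Resolved → ∀ r (M : Model θ) (enumerated : Enumerated (Model.str M)) →
    let open Model M
        open Ends str linear
        open ChainMembership sto
    in ∀ {k l} (K : Known ⊥ k l) (c : Chain r l ⊤±) → (∀ j → Mem [ param j ] K ⊎ InChain [ param j ] c) → ⊥
  advance unresolved zero M enumerated K (Ends.nil l<⊤) split =
    Gap.not-finite⇒⊥ M enumerated l<⊤ apart bounded K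
      λ (_ , K' , sub) → unresolved (M , _ , K' , sub ∘ known)
    where
    open Model M
    open Ends str linear

    known : ∀ j → Mem [ param j ] K
    known j with split j
    ... | inj₁ p∈ = p∈

    apart : ∀ j → [ param j ] ≤ _ ⊎ ⊤± ≤ [ param j ]
    apart j = inj₁ (Mem⇒≤ K (known j))

    bounded : ¬ (∀ m → Chain m _ ⊤±)
    bounded chains = unresolved (densified , _ , densified-Known K , λ j →
      subst (λ e → D.Mem e (densified-Known K)) (keep-out (param j) (params-outside j))
        (densified-Mem K (known j)))
      where
      open Splice str linear _ ⊤±
      params-outside : ∀ j → ¬ Inside [ param j ]
      params-outside j = ≤l⇒outside (Mem⇒≤ K (known j))
      open Densify univ M enumerated l<⊤ chains params-outside
  advance unresolved (suc r) M enumerated K (Ends.cons x l<x c) split =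
    Gap.not-finite⇒⊥ M enumerated l<x apart bounded K
      λ (_ , K' , sub) → advance unresolved r M enumerated K' c (extend-split K' sub)
    where
    open Model M
    open Ends str linear
    open ChainMembership sto

    apart : ∀ j → [ param j ] ≤ _ ⊎ x ≤ [ param j ]
    apart j with split j
    ... | inj₁ p∈          = inj₁ (Mem⇒≤ K p∈)
    ... | inj₂ (inj₁ refl) = inj₂ ≤-refl
    ... | inj₂ (inj₂ p∈)   = inj₂ (inj₁ (inChain⇒< c p∈))

    extend-split : ∀ {k'} (K' : Known ⊥ k' x) → (∀ {e} → Mem e K → Mem e K') →
                   ∀ j → Mem [ param j ] K' ⊎ InChain [ param j ] c
    extend-split K' sub j with split j
    ... | inj₁ p∈        = inj₁ (sub p∈)
    ... | inj₂ (inj₁ e)  = inj₁ (subst (λ e → Mem e K') (sym e) (endpoint-Mem K'))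
    ... | inj₂ (inj₂ p∈) = inj₂ p∈

    bounded : ¬ (∀ m → Chain m _ x)
    bounded chains = advance unresolved r densified D-enumerated (densified-Known K) (keep-chain ≤-refl c)
      keep-split
      where
      open Splice str linear _ x
      params-outside : ∀ j → ¬ Inside [ param j ]
      params-outside j i = Sum.[ (λ p≤l → ≤l⇒outside p≤l i) , (λ x≤p → u≤⇒outside x≤p i) ] (apart j)
      open Densify univ M enumerated l<x chains params-outside

      keep-chain : ∀ {m y} → x ≤ y → Chain m y ⊤± → D.Chain m (keep y) ⊤±
      keep-chain x≤y (nil y<⊤)      = D.nil (keep-mono (u≤⇒outside x≤y) ⊤-outside y<⊤)
        where
        ⊤-outside : ¬ Inside ⊤±
        ⊤-outside (_ , ⊤<x) = ⊤≮ ⊤<x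
      keep-chain x≤y (cons z y<z c) = D.cons (keep z) (keep-mono (u≤⇒outside x≤y) (u≤⇒outside x≤z) y<z)
                                        (keep-chain x≤z c)
        where x≤z = inj₁ (≤-<-trans x≤y y<z)

      keep-inChain : ∀ {m y e} (x≤y : x ≤ y) (c : Chain m y ⊤±) → InChain e c →
                     ChainMembership.InChain D.sto (keep e) (keep-chain x≤y c)
      keep-inChain x≤y (cons z y<z c) (inj₁ refl) = inj₁ refl
      keep-inChain x≤y (cons z y<z c) (inj₂ e∈)   = inj₂ (keep-inChain _ c e∈)

      keep-split : ∀ j → D.Mem [ paramD j ] (densified-Known K) ⊎
                         ChainMembership.InChain D.sto [ paramD j ] (keep-chain ≤-refl c)
      keep-split j = subst (λ e → D.Mem e (densified-Known K) ⊎
                                  ChainMembership.InChain D.sto e (keep-chain ≤-refl c))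
        (keep-out (param j) (params-outside j)) (go (split j))
        where
        go : Mem [ param j ] K ⊎ InChain [ param j ] (cons x l<x c) → _
        go (inj₁ p∈)        = inj₁ (densified-Mem K p∈)
        go (inj₂ (inj₁ e))  = inj₁ (subst (λ e → D.Mem (keep e) (densified-Known K)) (sym e) (inj₂ refl))
        go (inj₂ (inj₂ p∈)) = inj₂ (keep-inChain ≤-refl c p∈)

  resolved : Model θ → ¬ ¬ Resolved
  resolved M unresolved =
    let m , c , all = collect ⊥±<⊤± ([_] ∘ param) (λ j → ⊥±<[ _ ] , [ _ ]<⊤±)
    in advance unresolved m hullModel hull-enumerated (start λ _ → ≮⊥) c (inj₂ ∘ all)
    where
    open Hull univ M
    open Model hullModel
    open Ends str linear
    open ChainMembership sto

-- The Scott sentence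

Tm : ℕ → Set
Tm n = Fin n ±

map±-∘ : {X Y Z : Set} (g : Y → Z) (f : X → Y) (e : X ±) → map± g (map± f e) ≡ map± (g ∘ f) e
map±-∘ g f ⊥±    = refl
map±-∘ g f [ x ] = refl
map±-∘ g f ⊤±    = refl

-- Rules out pairs such as `⊤±` below `⊤±`, whose false inequality would pass a universally
-- quantified guard in an empty structure.
Separated : ∀ {n} → Tm n → Tm n → Set
Separated _     [ _ ] = ⊤
Separated ⊥±    ⊤±    = ⊤
Separated [ _ ] ⊤±    = ⊤
Separated _     _     = ⊥

data Shape (n : ℕ) : ℕ → Tm n → Set where
  start  : Shape n 0 ⊥±
  emptyG : ∀ {k t} → Shape n k t → ∀ t' → Separated t t' → Shape n (suc k) t'
  denseG : ∀ {k t} → Shape n k t → ∀ t' → Separated t t' → Shape n k t'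

module _ {n m : ℕ} (f : Fin n → Fin m) where

  rename-separated : ∀ {t t'} → Separated t t' → Separated (map± f t) (map± f t')
  rename-separated {_}     {[ _ ]} _ = tt
  rename-separated {⊥±}    {⊤±}    _ = tt
  rename-separated {[ _ ]} {⊤±}    _ = tt

  rename : ∀ {k t} → Shape n k t → Shape m k (map± f t)
  rename start              = start
  rename (emptyG {t = t} sh t' s) = emptyG (rename sh) (map± f t') (rename-separated {t} {t'} s)
  rename (denseG {t = t} sh t' s) = denseG (rename sh) (map± f t') (rename-separated {t} {t'} s)

data DenseGap {n} : ∀ {k t} → Shape n k t → Tm n → Tm n → Set where
  here   : ∀ {k t t' s} {sh : Shape n k t} → DenseGap (denseG sh t' s) t t'
  underE : ∀ {k t t' s l u} {sh : Shape n k t} → DenseGap sh l u → DenseGap (emptyG sh t' s) l u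
  underD : ∀ {k t t' s l u} {sh : Shape n k t} → DenseGap sh l u → DenseGap (denseG sh t' s) l u

rename-gap : ∀ {n m} (f : Fin n → Fin m) {k t l u} {sh : Shape n k t} → DenseGap sh l u →
             DenseGap (rename f sh) (map± f l) (map± f u)
rename-gap f here       = here
rename-gap f (underE d) = underE (rename-gap f d)
rename-gap f (underD d) = underD (rename-gap f d)

ends : ∀ {n k t} → Shape n k t → List (Tm n)
ends start            = ⊥± ∷ []
ends (emptyG sh t' _) = t' ∷ ends sh
ends (denseG sh t' _) = t' ∷ ends sh

last∈ends : ∀ {n k t} (sh : Shape n k t) → t ∈ ends sh
last∈ends start          = here refl
last∈ends (emptyG _ _ _) = here refl
last∈ends (denseG _ _ _) = here refl

⊥∈ends : ∀ {n k t} (sh : Shape n k t) → ⊥± ∈ ends sh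
⊥∈ends start           = here refl
⊥∈ends (emptyG sh _ _) = there (⊥∈ends sh)
⊥∈ends (denseG sh _ _) = there (⊥∈ends sh)

rename-ends : ∀ {n m} (f : Fin n → Fin m) {k t} (sh : Shape n k t) {e} → e ∈ ends sh →
              map± f e ∈ ends (rename f sh)
rename-ends f start           (here refl) = here refl
rename-ends f (emptyG sh _ _) (here refl) = here refl
rename-ends f (emptyG sh _ _) (there e∈)  = there (rename-ends f sh e∈)
rename-ends f (denseG sh _ _) (here refl) = here refl
rename-ends f (denseG sh _ _) (there e∈)  = there (rename-ends f sh e∈)

-- Realisations of a shape

module Semantics (A : Structure) (lin : IsLinearOrdering A) where
  open Ends A lin

  eval : ∀ {n} → (Fin n → Carrier A) → Tm n → Carrier A ±
  eval = map±

  module _ {n} (ρ : Fin n → Carrier A) where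

    Ordered : ∀ {k t} → Shape n k t → Set
    Ordered start                    = ⊤
    Ordered (emptyG {t = t} sh t' _) = Ordered sh × eval ρ t <± eval ρ t'
    Ordered (denseG {t = t} sh t' _) = Ordered sh × eval ρ t <± eval ρ t'

    EmptyGaps : ∀ {k t} → Shape n k t → Set
    EmptyGaps start                    = ⊤
    EmptyGaps (emptyG {t = t} sh t' _) = EmptyGaps sh × (∀ z → ¬ Between (eval ρ t) (eval ρ t') z)
    EmptyGaps (denseG sh _ _)          = EmptyGaps sh

    Filled : Tm n → Tm n → Set
    Filled t t' = ∀ x y → eval ρ t ≤ x → x <± y → y ≤ eval ρ t' → ∃ (Between x y)

    DenseGaps : ∀ {k t} → Shape n k t → Set
    DenseGaps start                    = ⊤
    DenseGaps (emptyG sh _ _)          = DenseGaps sh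
    DenseGaps (denseG {t = t} sh t' _) = DenseGaps sh × Filled t t'

    ends-≤ : ∀ {k t} (sh : Shape n k t) → Ordered sh → ∀ {e} → e ∈ ends sh → eval ρ e ≤ eval ρ t
    ends-≤ start           _         (here refl) = ≤-refl
    ends-≤ (emptyG sh _ _) (o , t<t') (here refl) = ≤-refl
    ends-≤ (emptyG sh _ _) (o , t<t') (there e∈)  = ≤-trans (ends-≤ sh o e∈) (inj₁ t<t')
    ends-≤ (denseG sh _ _) (o , t<t') (here refl) = ≤-refl
    ends-≤ (denseG sh _ _) (o , t<t') (there e∈)  = ≤-trans (ends-≤ sh o e∈) (inj₁ t<t')

    ordered? : ∀ {k t} (sh : Shape n k t) → Dec (Ordered sh)
    ordered? start = yes tt
    ordered? (emptyG {t = t} sh t' _) with ordered? sh | eval ρ t <? eval ρ t'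
    ... | yes o | yes p = yes (o , p)
    ... | no ¬o | _     = no (¬o ∘ proj₁)
    ... | _     | no ¬p = no (¬p ∘ proj₂)
    ordered? (denseG {t = t} sh t' _) with ordered? sh | eval ρ t <? eval ρ t'
    ... | yes o | yes p = yes (o , p)
    ... | no ¬o | _     = no (¬o ∘ proj₁)
    ... | _     | no ¬p = no (¬p ∘ proj₂)

    gap-filled : ∀ {k t} {sh : Shape n k t} {l u} → DenseGap sh l u → Ordered sh → DenseGaps sh →
                 ∃ (Between (eval ρ l) (eval ρ u))
    gap-filled here       (_ , l<u) (_ , fill) = fill _ _ ≤-refl l<u ≤-refl
    gap-filled (underE d) (o , _)   dg         = gap-filled d o dg
    gap-filled (underD d) (o , _)   (dg , _)   = gap-filled d o dg

  module _ {n m} (f : Fin n → Fin m) {ρ : Fin n → Carrier A} {ρ' : Fin m → Carrier A}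
    (agree : ∀ t → eval ρ' (map± f t) ≡ eval ρ t) where

    rename-ordered : ∀ {k t} (sh : Shape n k t) → Ordered ρ sh → Ordered ρ' (rename f sh)
    rename-ordered start _ = tt
    rename-ordered (emptyG {t = t} sh t' _) (o , p) rewrite agree t | agree t' = rename-ordered sh o , p
    rename-ordered (denseG {t = t} sh t' _) (o , p) rewrite agree t | agree t' = rename-ordered sh o , p

    rename-empty : ∀ {k t} (sh : Shape n k t) → EmptyGaps ρ sh → EmptyGaps ρ' (rename f sh)
    rename-empty start _ = tt
    rename-empty (emptyG {t = t} sh t' _) (o , p) rewrite agree t | agree t' = rename-empty sh o , p
    rename-empty (denseG sh _ _) o = rename-empty sh o

    rename-dense : ∀ {k t} (sh : Shape n k t) → DenseGaps ρ sh → DenseGaps ρ' (rename f sh)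
    rename-dense start _ = tt
    rename-dense (emptyG sh _ _) o = rename-dense sh o
    rename-dense (denseG {t = t} sh t' _) (o , p) rewrite agree t | agree t' = rename-dense sh o , p

  -- A decomposition speaks of elements of one structure. Naming its endpoints by variables lets
  -- other structures realise the same pattern.
  record Named {k b} (K : Known ⊥ k b) : Set where
    field
      {size}  : ℕ
      {ρ}     : Fin size → Carrier A
      {t}     : Tm size
      shape   : Shape size k t
      last    : eval ρ t ≡ b
      ordered : Ordered ρ shape
      gapless : EmptyGaps ρ shape
      filled  : DenseGaps ρ shape
      covers  : ∀ {e} → Mem e K → ∃[ t' ] (t' ∈ ends shape × eval ρ t' ≡ e)

  record NewEnd {n} (ρ : Fin n → Carrier A) (t : Tm n) (u : Carrier A ±) : Set where
    field
      {size} : ℕ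
      ρ'     : Fin size → Carrier A
      f      : Fin n → Fin size
      agree  : ∀ t → eval ρ' (map± f t) ≡ eval ρ t
      t'     : Tm size
      at-u   : eval ρ' t' ≡ u
      apart  : Separated (map± f t) t'

  newEnd : ∀ {n} (ρ : Fin n → Carrier A) t u → eval ρ t <± u → NewEnd ρ t u
  newEnd ρ t ⊥± p = ⊥-elim (≮⊥ p)
  newEnd ρ t [ x ] p = record
    { ρ' = extend x ρ ; f = suc ; agree = map±-∘ (extend x ρ) suc ; t' = [ zero ] ; at-u = refl ; apart = tt }
  newEnd ρ t ⊤± p = record
    { ρ' = ρ ; f = id ; agree = map±-∘ ρ id ; t' = ⊤± ; at-u = refl ; apart = separated t p }
    where
    separated : ∀ t → eval ρ t <± ⊤± → Separated (map± id t) ⊤±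
    separated ⊥±    _ = tt
    separated [ _ ] _ = tt
    separated ⊤±    p = <-irr p

  name : ∀ {k b} (K : Known ⊥ k b) → Named K
  name {b = ⊥±} (start none) = record
    { size = 0 ; ρ = λ () ; shape = start ; last = refl ; ordered = tt ; gapless = tt
    ; filled = tt ; covers = λ { refl → ⊥± , here refl , refl } }
  name {b = [ x ]} (start none) = ⊥-elim (none ⊥± ⊥±<[ x ])
  name {b = ⊤±}    (start none) = ⊥-elim (none ⊥± ⊥±<⊤±)
  name (empty {l = l} {u} K l<u e) with name K
  ... | record { ρ = ρ ; t = t ; shape = sh ; last = refl ; ordered = o ; gapless = g ; filled = d ; covers = c }
    with newEnd ρ t u l<u
  ... | record { ρ' = ρ' ; f = f ; agree = agree ; t' = t' ; at-u = refl ; apart = s } = record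
    { shape = emptyG (rename f sh) t' s
    ; last = refl
    ; ordered = rename-ordered f agree sh o , subst (_<± eval ρ' t') (sym (agree t)) l<u
    ; gapless = rename-empty f agree sh g , subst (λ y → ∀ z → ¬ Between y (eval ρ' t') z) (sym (agree t)) e
    ; filled = rename-dense f agree sh d
    ; covers = λ
      { (inj₁ e∈)   → let t'' , t''∈ , e' = c e∈ in
          map± f t'' , there (rename-ends f sh t''∈) , trans (agree t'') e'
      ; (inj₂ refl) → t' , here refl , refl } }
  name (dense {l = l} {u} K l<u d') with name K
  ... | record { ρ = ρ ; t = t ; shape = sh ; last = refl ; ordered = o ; gapless = g ; filled = d ; covers = c }
    with newEnd ρ t u l<u
  ... | record { ρ' = ρ' ; f = f ; agree = agree ; t' = t' ; at-u = refl ; apart = s } = record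
    { shape = denseG (rename f sh) t' s
    ; last = refl
    ; ordered = rename-ordered f agree sh o , subst (_<± eval ρ' t') (sym (agree t)) l<u
    ; gapless = rename-empty f agree sh g
    ; filled = rename-dense f agree sh d , λ x y l≤x x<y y≤u →
        Sum.[ ⊥-elim , id ] (d' x y (subst (_≤ x) (agree t) l≤x) x<y y≤u)
    ; covers = λ
      { (inj₁ e∈)   → let t'' , t''∈ , e' = c e∈ in
          map± f t'' , there (rename-ends f sh t''∈) , trans (agree t'') e'
      ; (inj₂ refl) → t' , here refl , refl } }

-- Formulas for a shape, and their truth

true : ∀ {m} → Formula (suc m)
true = eq zero zero

-- Comparisons with an infinite end are settled outright. Formulas have no constant for truth, so
-- `true` borrows a variable, and one must be in scope.
lt : ∀ {m} → Tm (suc m) → Tm (suc m) → Formula (suc m)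
lt ⊥±    [ _ ] = true
lt ⊥±    ⊤±    = true
lt [ _ ] ⊤±    = true
lt [ i ] [ j ] = rel i j
lt _     _     = neg true

wk : ∀ {m} → Tm m → Tm (suc m)
wk = map± suc

-- The instance, at the point named by variable `zero`, of the statement that the tuple is ordered
-- and its designated gaps are empty. This keeps it quantifier-free.
guard : ∀ {n k t} → Shape n k t → Formula (suc n)
guard start                    = true
guard (emptyG {t = t} sh t' _) =
  guard sh ∧ (lt (wk t) (wk t') ∧ neg (lt (wk t) [ zero ] ∧ lt [ zero ] (wk t')))
guard (denseG {t = t} sh t' _) = guard sh ∧ lt (wk t) (wk t')

-- Variable `zero` serves two purposes: its value either refutes the guard or lies between `p` and
-- `q`. One existential quantifier thus covers both the failure of the hypothesis and the density
-- claim, and the sentence stays Π₂.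
density : ∀ {n k t} → Shape n k t → (l u p q : Tm n) → Formula (suc n)
density sh l u p q = neg (guard sh) ∨
  (neg (neg (lt (wk p) (wk l)) ∧ (lt (wk p) (wk q) ∧ neg (lt (wk u) (wk q)))) ∨
   (lt (wk p) [ zero ] ∧ lt [ zero ] (wk q)))

lt-QF : ∀ {m} (s t : Tm (suc m)) → QF (lt s t)
lt-QF ⊥±    ⊥±    = qf-neg (qf-eq _ _)
lt-QF ⊥±    [ _ ] = qf-eq _ _
lt-QF ⊥±    ⊤±    = qf-eq _ _
lt-QF [ _ ] ⊥±    = qf-neg (qf-eq _ _)
lt-QF [ _ ] [ _ ] = qf-rel _ _
lt-QF [ _ ] ⊤±    = qf-eq _ _
lt-QF ⊤±    ⊥±    = qf-neg (qf-eq _ _)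
lt-QF ⊤±    [ _ ] = qf-neg (qf-eq _ _)
lt-QF ⊤±    ⊤±    = qf-neg (qf-eq _ _)

guard-QF : ∀ {n k t} (sh : Shape n k t) → QF (guard sh)
guard-QF start           = qf-eq _ _
guard-QF (emptyG sh _ _) =
  qf-∧ (guard-QF sh) (qf-∧ (lt-QF _ _) (qf-neg (qf-∧ (lt-QF _ _) (lt-QF _ _))))
guard-QF (denseG sh _ _) = qf-∧ (guard-QF sh) (lt-QF _ _)

density-QF : ∀ {n k t} (sh : Shape n k t) l u p q → QF (density sh l u p q)
density-QF sh l u p q = qf-∨ (qf-neg (guard-QF sh)) (qf-∨
  (qf-neg (qf-∧ (qf-neg (lt-QF _ _)) (qf-∧ (lt-QF _ _) (qf-neg (lt-QF _ _)))))
  (qf-∧ (lt-QF _ _) (lt-QF _ _)))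

⇔-× : {P P' Q Q' : Set} → P ⇔ P' → Q ⇔ Q' → (P × Q) ⇔ (P' × Q')
⇔-× p q = mk⇔ (λ (x , y) → to p x , to q y) (λ (x , y) → from p x , from q y)

⇔-⊎ : {P P' Q Q' : Set} → P ⇔ P' → Q ⇔ Q' → (P ⊎ Q) ⇔ (P' ⊎ Q')
⇔-⊎ p q = mk⇔ (Sum.map (to p) (to q)) (Sum.map (from p) (from q))

⇔-¬ : {P P' : Set} → P ⇔ P' → (¬ P) ⇔ (¬ P')
⇔-¬ p = mk⇔ (_∘ from p) (_∘ to p)

module Truth (A : Structure) (lin : IsLinearOrdering A) where
  open Ends A lin
  open Semantics A lin

  lt-⇔ : ∀ {m} (ρ : Fin (suc m) → Carrier A) s t → Sat A ρ (lt s t) ⇔ eval ρ s <± eval ρ t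
  lt-⇔ ρ ⊥±    ⊥±    = mk⇔ (λ ¬t → ⊥-elim (¬t refl)) (λ p → ⊥-elim (<-irr p))
  lt-⇔ ρ ⊥±    [ j ] = mk⇔ (λ _ → ⊥±<[ ρ j ]) (λ _ → refl)
  lt-⇔ ρ ⊥±    ⊤±    = mk⇔ (λ _ → ⊥±<⊤±) (λ _ → refl)
  lt-⇔ ρ [ i ] ⊥±    = mk⇔ (λ ¬t → ⊥-elim (¬t refl)) (λ p → ⊥-elim (≮⊥ p))
  lt-⇔ ρ [ i ] [ j ] = mk⇔ lift lower
  lt-⇔ ρ [ i ] ⊤±    = mk⇔ (λ _ → [ ρ i ]<⊤±) (λ _ → refl)
  lt-⇔ ρ ⊤±    ⊥±    = mk⇔ (λ ¬t → ⊥-elim (¬t refl)) (λ p → ⊥-elim (≮⊥ p))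
  lt-⇔ ρ ⊤±    [ j ] = mk⇔ (λ ¬t → ⊥-elim (¬t refl)) (λ p → ⊥-elim (⊤≮ p))
  lt-⇔ ρ ⊤±    ⊤±    = mk⇔ (λ ¬t → ⊥-elim (¬t refl)) (λ p → ⊥-elim (<-irr p))

  module _ {n} (ρ : Fin n → Carrier A) where

    Guard : Carrier A → ∀ {k t} → Shape n k t → Set
    Guard z start                    = ⊤
    Guard z (emptyG {t = t} sh t' _) =
      Guard z sh × (eval ρ t <± eval ρ t' × ¬ Between (eval ρ t) (eval ρ t') [ z ])
    Guard z (denseG {t = t} sh t' _) = Guard z sh × eval ρ t <± eval ρ t'

    Density : Carrier A → ∀ {k t} → Shape n k t → (l u p q : Tm n) → Set
    Density z sh l u p q = ¬ Guard z sh ⊎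
      (¬ (¬ (eval ρ p <± eval ρ l) × (eval ρ p <± eval ρ q × ¬ (eval ρ u <± eval ρ q))) ⊎
       Between (eval ρ p) (eval ρ q) [ z ])

    module _ (z : Carrier A) where

      lt-wk : ∀ s t → Sat A (extend z ρ) (lt (wk s) (wk t)) ⇔ eval ρ s <± eval ρ t
      lt-wk s t with lt-⇔ (extend z ρ) (wk s) (wk t)
      ... | h rewrite map±-∘ (extend z ρ) suc s | map±-∘ (extend z ρ) suc t = h

      lt-wk-0 : ∀ s → Sat A (extend z ρ) (lt (wk s) [ zero ]) ⇔ eval ρ s <± [ z ]
      lt-wk-0 s with lt-⇔ (extend z ρ) (wk s) [ zero ]
      ... | h rewrite map±-∘ (extend z ρ) suc s = h

      lt-0-wk : ∀ t → Sat A (extend z ρ) (lt [ zero ] (wk t)) ⇔ [ z ] <± eval ρ t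
      lt-0-wk t with lt-⇔ (extend z ρ) [ zero ] (wk t)
      ... | h rewrite map±-∘ (extend z ρ) suc t = h

      guard-⇔ : ∀ {k t} (sh : Shape n k t) → Sat A (extend z ρ) (guard sh) ⇔ Guard z sh
      guard-⇔ start = mk⇔ (λ _ → tt) (λ _ → refl)
      guard-⇔ (emptyG {t = t} sh t' _) =
        ⇔-× (guard-⇔ sh) (⇔-× (lt-wk t t') (⇔-¬ (⇔-× (lt-wk-0 t) (lt-0-wk t'))))
      guard-⇔ (denseG {t = t} sh t' _) = ⇔-× (guard-⇔ sh) (lt-wk t t')

      density-⇔ : ∀ {k t} (sh : Shape n k t) l u p q →
                  Sat A (extend z ρ) (density sh l u p q) ⇔ Density z sh l u p q
      density-⇔ sh l u p q = ⇔-⊎ (⇔-¬ (guard-⇔ sh)) (⇔-⊎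
        (⇔-¬ (⇔-× (⇔-¬ (lt-wk p l)) (⇔-× (lt-wk p q) (⇔-¬ (lt-wk u q)))))
        (⇔-× (lt-wk-0 p) (lt-0-wk q)))

    Guard⇒Ordered : ∀ {z k t} (sh : Shape n k t) → Guard z sh → Ordered ρ sh
    Guard⇒Ordered start           _               = tt
    Guard⇒Ordered (emptyG sh _ _) (g , t<t' , _) = Guard⇒Ordered sh g , t<t'
    Guard⇒Ordered (denseG sh _ _) (g , t<t')     = Guard⇒Ordered sh g , t<t'

    EmptyGaps⇒Guard : ∀ {k t} (sh : Shape n k t) → Ordered ρ sh → EmptyGaps ρ sh → ∀ z → Guard z sh
    EmptyGaps⇒Guard start           _          _       z = tt
    EmptyGaps⇒Guard (emptyG sh _ _) (o , t<t') (g , e) z = EmptyGaps⇒Guard sh o g z , t<t' , e [ z ]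
    EmptyGaps⇒Guard (denseG sh _ _) (o , t<t') g       z = EmptyGaps⇒Guard sh o g z , t<t'

    -- A variable in an endpoint provides the point needed to use the guard.
    guarded-< : ∀ t t' → Separated t t' → (Carrier A → eval ρ t <± eval ρ t') → eval ρ t <± eval ρ t'
    guarded-< _     [ i ] _ f = f (ρ i)
    guarded-< ⊥±    ⊤±    _ f = ⊥±<⊤±
    guarded-< [ i ] ⊤±    _ f = [ ρ i ]<⊤±

    guarded-ordered : ∀ {k t} (sh : Shape n k t) → (∀ z → Guard z sh) → Ordered ρ sh
    guarded-ordered start                    _ = tt
    guarded-ordered (emptyG {t = t} sh t' s) g =
      guarded-ordered sh (proj₁ ∘ g) , guarded-< t t' s (λ z → proj₁ (proj₂ (g z)))
    guarded-ordered (denseG {t = t} sh t' s) g =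
      guarded-ordered sh (proj₁ ∘ g) , guarded-< t t' s (λ z → proj₂ (g z))

    guarded-empty : ∀ {k t} (sh : Shape n k t) → (∀ z → Guard z sh) → EmptyGaps ρ sh
    guarded-empty start                     _ = tt
    guarded-empty (emptyG sh _ _) g = guarded-empty sh (proj₁ ∘ g) , gap
      where
      gap : ∀ e → ¬ Between _ _ e
      gap e e∈ with point e∈
      ... | z , refl = proj₂ (proj₂ (g z)) e∈
    guarded-empty (denseG sh _ _)           g = guarded-empty sh (proj₁ ∘ g)

    -- The tuple need only be ordered; its designated gaps may be inhabited, and a hit then names a
    -- point at which the guard fails.
    shape-pairs : ∀ {k t} (sh : Shape n k t) → Ordered ρ sh →
                  Σ[ c ∈ Pairs k (eval ρ t) ] (Hit c → ∃[ z ] ¬ Guard z sh)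
    shape-pairs start _ = [] , λ ()
    shape-pairs (emptyG sh t' _) (o , t<t') with shape-pairs sh o
    ... | c , hit = snoc c t<t' ≤-refl , λ where
      (inj₁ h) → let z , ¬g = hit h in z , ¬g ∘ proj₁
      (inj₂ (e , e∈)) → let z , e' = point e∈ in
        z , λ (_ , _ , ¬z) → ¬z (subst (Between _ _) e' e∈)
    shape-pairs (denseG sh t' _) (o , t<t') with shape-pairs sh o
    ... | c , hit = weaken (inj₁ t<t') c , λ h →
      let z , ¬g = hit (Hit-weaken (inj₁ t<t') c h) in z , ¬g ∘ proj₁

    -- A dense gap contributes no pair to `shape-pairs`, so there is room in it for `p` and `q` as
    -- an additional one.
    shape-pairs⁺ : ∀ {k t} {sh : Shape n k t} {l u p q} → DenseGap sh l u → Ordered ρ sh →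
      eval ρ l ≤ eval ρ p → eval ρ p <± eval ρ q → eval ρ q ≤ eval ρ u →
      Σ[ c ∈ Pairs (suc k) (eval ρ t) ] (Hit c → ∃[ z ] (¬ Guard z sh ⊎ Between (eval ρ p) (eval ρ q) [ z ]))
    shape-pairs⁺ (here {sh = sh}) (o , _) l≤p p<q q≤u with shape-pairs sh o
    ... | c , hit = snoc (weaken l≤p c) p<q q≤u , λ where
      (inj₁ h) → let z , ¬g = hit (Hit-weaken l≤p c h) in z , inj₁ (¬g ∘ proj₁)
      (inj₂ (e , e∈)) → let z , e' = point e∈ in z , inj₂ (subst (Between _ _) e' e∈)
    shape-pairs⁺ (underE d) (o , t<t') l≤p p<q q≤u with shape-pairs⁺ d o l≤p p<q q≤u
    ... | c , hit = snoc c t<t' ≤-refl , λ where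
      (inj₁ h) → let z , r = hit h in z , Sum.map₁ (_∘ proj₁) r
      (inj₂ (e , e∈)) → let z , e' = point e∈ in
        z , inj₁ λ (_ , _ , ¬z) → ¬z (subst (Between _ _) e' e∈)
    shape-pairs⁺ (underD d) (o , t<t') l≤p p<q q≤u with shape-pairs⁺ d o l≤p p<q q≤u
    ... | c , hit = weaken (inj₁ t<t') c , λ h →
      let z , r = hit (Hit-weaken (inj₁ t<t') c h) in z , Sum.map₁ (_∘ proj₁) r

    -- A counterexample would give one empty gap too many.
    density-holds : ∀ {k t} → Known ⊥ k ⊤± → {sh : Shape n k t} → ∀ {l u} → DenseGap sh l u → Carrier A →
                    ∀ p q → ∃[ z ] Density z sh l u p q
    density-holds K {sh} {l} {u} d z₀ p q
      with ordered? ρ sh | eval ρ p <? eval ρ l | eval ρ p <? eval ρ q | eval ρ u <? eval ρ q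
    ... | no ¬o | _       | _       | _       = z₀ , inj₁ (¬o ∘ Guard⇒Ordered sh)
    ... | _     | yes p<l | _       | _       = z₀ , inj₂ (inj₁ λ (p≮l , _) → p≮l p<l)
    ... | _     | _       | no p≮q  | _       = z₀ , inj₂ (inj₁ λ (_ , p<q , _) → p≮q p<q)
    ... | _     | _       | _       | yes u<q = z₀ , inj₂ (inj₁ λ (_ , _ , u≮q) → u≮q u<q)
    ... | yes o | no p≮l  | yes p<q | no u≮q with shape-pairs⁺ d o (≮⇒≥ p≮l) p<q (≮⇒≥ u≮q)
    ...   | c , hit with pigeonhole K (weaken ≤⊤ c)
    ...     | inj₂ h = let z , r = hit (Hit-weaken ≤⊤ c h) in z , Sum.map₂ inj₂ r

-- Back and forth between two realisations of a shape

module Correspondence {A B : Structure} (linA : IsLinearOrdering A) (linB : IsLinearOrdering B)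
  {n k : ℕ} (sh : Shape n k ⊤±) where
  private
    module A = Ends A linA
    module B = Ends B linB
    module SA = Semantics A linA
    module SB = Semantics B linB
  open PartialIso {A} {B} linA linB public

  module _ (ρ : Fin n → Carrier A) (ρ' : Fin n → Carrier B) where

    endpoint : Tm n → Pair
    endpoint t = SA.eval ρ t , SB.eval ρ' t

    endpoint∈ : ∀ {j t} {sub : Shape n j t} {e} → e ∈ ends sub → endpoint e ∈ map endpoint (ends sub)
    endpoint∈ = ∈-map⁺ endpoint

    end-above : ∀ {j t t'} (sub : Shape n j t) → SA.Ordered ρ sub → SB.Ordered ρ' sub →
                SA.eval ρ t A.<± SA.eval ρ t' → SB.eval ρ' t B.<± SB.eval ρ' t' →
                ∀ {q} → q ∈ map endpoint (ends sub) → Sim (endpoint t') q × Sim q (endpoint t')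
    end-above {t' = t'} sub oA oB t<t' t<t'′ q∈ with ∈-map⁻ endpoint q∈
    ... | e , e∈ , refl =
      ( (λ t'<e → ⊥-elim (A.asym t'<e e<t')) , (λ t'≡e → ⊥-elim (A.<-irr (subst (A._<± _) (sym t'≡e) e<t'))) ) ,
      ( (λ _ → B.≤-<-trans (SB.ends-≤ ρ' sub oB e∈) t<t'′)
      , (λ e≡t' → ⊥-elim (A.<-irr (subst (A._<± _) e≡t' e<t'))) )
      where
      e<t' : SA.eval ρ e A.<± SA.eval ρ t'
      e<t' = A.≤-<-trans (SA.ends-≤ ρ sub oA e∈) t<t'

    good-ends : ∀ {j t} (sub : Shape n j t) → SA.Ordered ρ sub → SB.Ordered ρ' sub →
                Good (map endpoint (ends sub))
    good-ends start _ _ (here refl) (here refl) = sim-refl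
    good-ends (emptyG sub t' _) (oA , p) (oB , q) = good-cons (good-ends sub oA oB) (end-above sub oA oB p q)
    good-ends (denseG sub t' _) (oA , p) (oB , q) = good-cons (good-ends sub oA oB) (end-above sub oA oB p q)

    Rel : ∀ {m} → (Fin m → Carrier A) → (Fin m → Carrier B) → Set
    Rel σ σ' = Σ[ L ∈ List Pair ] Good L × (∀ {t} → t ∈ ends sh → endpoint t ∈ L) × Linked L σ σ'

    module _ (gaplessA : SA.EmptyGaps ρ sh) (filledB : SB.DenseGaps ρ' sh) where

      -- Descends to the gap of the shape that contains `a`. It is not one of the empty gaps, and
      -- `a` is no endpoint because the endpoints are listed. So the gap is dense, and density in
      -- `B` fills the space between the partners of the neighbours of `a`.
      absorb : ∀ {L a} → Good L → (nb : Neighbours L [ a ]) → let open Neighbours nb in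
        ∀ {j t} (sub : Shape n j t) → (∀ {e} → e ∈ ends sub → endpoint e ∈ L) →
        SA.EmptyGaps ρ sub → SB.DenseGaps ρ' sub → [ a ] A.<± SA.eval ρ t → ∃ (B.Between l' u')
      absorb good nb start _ _ _ a<⊥ = ⊥-elim (A.≮⊥ a<⊥)
      absorb {L} {a} good nb@(neighbours l∈ u∈ l<a a<u apart) (emptyG {t = t} sub t' _) ends⊆ (g , none) d a<t'
        with A.compare [ a ] (SA.eval ρ t)
      ... | tri< a<t _ _ = absorb good nb sub (ends⊆ ∘ there) g d a<t
      ... | tri> _ _ t<a = ⊥-elim (none _ (t<a , a<t'))
      ... | tri≈ _ a≡t _ with apart (ends⊆ (there (last∈ends sub)))
      ...   | inj₁ t≤l = ⊥-elim (A.<⇒≱ l<a (subst (A._≤ _) (sym a≡t) t≤l))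
      ...   | inj₂ u≤t = ⊥-elim (A.<⇒≱ a<u (subst (_ A.≤_) (sym a≡t) u≤t))
      absorb {L} {a} good nb@(neighbours l∈ u∈ l<a a<u apart) (denseG {t = t} sub t' _) ends⊆ g (d , fill) a<t'
        with A.compare [ a ] (SA.eval ρ t)
      ... | tri< a<t _ _ = absorb good nb sub (ends⊆ ∘ there) g d a<t
      ... | tri≈ _ a≡t _ with apart (ends⊆ (there (last∈ends sub)))
      ...   | inj₁ t≤l = ⊥-elim (A.<⇒≱ l<a (subst (A._≤ _) (sym a≡t) t≤l))
      ...   | inj₂ u≤t = ⊥-elim (A.<⇒≱ a<u (subst (_ A.≤_) (sym a≡t) u≤t))
      absorb {L} {a} good nb@(neighbours l∈ u∈ l<a a<u apart) (denseG {t = t} sub t' _) ends⊆ g (d , fill) a<t'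
        | tri> _ _ t<a = fill _ _ (good-≤ good t∈ l∈ t≤l) (proj₁ (good l∈ u∈) (A.<-trans l<a a<u)) (good-≤ good u∈ t'∈ u≤t')
        where
        t∈  = ends⊆ (there (last∈ends sub))
        t'∈ = ends⊆ (here refl)

        t≤l : SA.eval ρ t A.≤ Neighbours.l nb
        t≤l = Sum.[ id , (λ u≤t → ⊥-elim (A.<⇒≱ (A.<-trans t<a a<u) u≤t)) ] (apart t∈)

        u≤t' : Neighbours.u nb A.≤ SA.eval ρ t'
        u≤t' = Sum.[ (λ t'≤l → ⊥-elim (A.<⇒≱ (A.<-trans l<a a<t') t'≤l)) , id ] (apart t'∈)

      forth : ∀ {m} {σ : Fin m → Carrier A} {σ'} → Rel σ σ' → ∀ a → ∃[ b ] Rel (extend a σ) (extend b σ')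
      forth (L , good , ends⊆ , r) a
        with locate L [ a ] (ends⊆ (⊥∈ends sh)) (ends⊆ (last∈ends sh)) A.⊥±<[ a ] A.[ a ]<⊤±
      ... | inj₁ (b' , ab∈) with B.point ( proj₁ (good (ends⊆ (⊥∈ends sh)) ab∈) A.⊥±<[ a ]
                                           , proj₁ (good ab∈ (ends⊆ (last∈ends sh))) A.[ a ]<⊤± )
      ...   | b , refl = b , L , good , ends⊆ , linked-extend ab∈ r
      forth (L , good , ends⊆ , r) a | inj₂ nb
        with absorb good nb sh ends⊆ gaplessA filledB A.[ a ]<⊤±
      ... | b' , b∈ with B.point b∈
      ...   | b , refl = b , _ ∷ L , good-insert good nb (proj₁ b∈) (proj₂ b∈) , there ∘ ends⊆
            , linked-extend (here refl) (there ∘ r)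

module _ {A B : Structure} (linA : IsLinearOrdering A) (linB : IsLinearOrdering B)
  {n k : ℕ} (sh : Shape n k ⊤±) {ρ : Fin n → Carrier A} {ρ' : Fin n → Carrier B} where
  private
    module SA = Semantics A linA
    module SB = Semantics B linB
    module AB = Correspondence {A} {B} linA linB sh
    module BA = Correspondence {B} {A} linB linA sh

  Rel-swap : ∀ {m} {σ : Fin m → Carrier A} {σ'} → BA.Rel ρ' ρ σ' σ → AB.Rel ρ ρ' σ σ'
  Rel-swap (L , good , ends⊆ , r) =
    map swap L , good' , (∈-map⁺ swap ∘ ends⊆) , (∈-map⁺ swap ∘ r)
    where

    good' : AB.Good (map swap L)
    good' p∈ q∈ with ∈-map⁻ swap p∈ | ∈-map⁻ swap q∈
    ... | _ , p , refl | _ , q , refl = BA.good-reflect good p q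

  -- A tuple of `B` is pulled back to `A` point by point, the theory is applied there, and the
  -- witnesses are carried forward. Only the theory is compared: the isomorphism comes from
  -- categoricity, so no enumeration of `B` is called for.
  realisation-reflects :
    SA.Ordered ρ sh → SA.EmptyGaps ρ sh → SA.DenseGaps ρ sh →
    SB.Ordered ρ' sh → SB.EmptyGaps ρ' sh → SB.DenseGaps ρ' sh →
    ∀ {p} (ix : Fin p → Fin n) → (∀ j → [ ix j ] ∈ ends sh) →
    {θ : ℕ → Formula p} → (∀ i → AllSig 1 (θ i)) → (∀ i → Sat A (ρ ∘ ix) (θ i)) → ∀ i → Sat B (ρ' ∘ ix) (θ i)
  realisation-reflects oA gA dA oB gB dB {p} ix ix∈ = theory-transfer {a = ρ ∘ ix} {ρ' ∘ ix} reflects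
    where
    open Forth {A} {B} {⊥} (AB.Rel ρ ρ') (λ (_ , good , _ , r) → AB.linked-rel good r)
      (λ (_ , good , _ , r) → AB.linked-eq good r) (λ r a → inj₂ (AB.forth ρ ρ' gA dB r a))

    pullback : ∀ k (σ' : Fin (k ℕ.+ p) → Carrier B) → Agree B (ρ' ∘ ix) k σ' →
               ∃[ σ ] (Agree A (ρ ∘ ix) k σ × BA.Rel ρ' ρ σ' σ)
    pullback zero σ' ag = ρ ∘ ix , (λ _ → refl) , _ , BA.good-ends ρ' ρ sh oB oA , BA.endpoint∈ ρ' ρ {sub = sh} ,
      λ j → subst (λ y → ([ y ] , [ ρ (ix j) ]) ∈ map (BA.endpoint ρ' ρ) (ends sh)) (sym (ag j))
              (BA.endpoint∈ ρ' ρ {sub = sh} (ix∈ j))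
    pullback (suc k) σ' ag with pullback k (σ' ∘ suc) ag
    ... | σ , agσ , r with BA.forth ρ' ρ gB dA r (σ' zero)
    ...   | a , L , good , ends⊆ , r' = extend a σ , agσ , L , good , ends⊆ ,
      λ { zero → r' zero ; (suc i) → r' (suc i) }

    reflects : ∀ k {c} {τ : Formula (k ℕ.+ p)} → c ℕ.≤ 1 → Sig c τ →
      (∀ σ → Agree A (ρ ∘ ix) k σ → Sat A σ τ) → ∀ σ' → Agree B (ρ' ∘ ix) k σ' → Sat B σ' τ
    reflects k c≤1 s pf σ' ag with pullback k σ' ag
    ... | σ , agσ , r = Sum.[ ⊥-elim , id ] (Sig-transfer c≤1 s (Rel-swap r) (pf σ agσ))

-- Assembling the sentence

orderAxioms : Formula 3
orderAxioms = neg (rel x x) ∧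
  ((neg (rel x y) ∨ (neg (rel y z) ∨ rel x z)) ∧ (rel x y ∨ (eq x y ∨ rel y x)))
  where
  x y z : Fin 3
  x = zero
  y = suc zero
  z = suc (suc zero)

linearity : Sentence
linearity = ∀^ 3 orderAxioms

linearity-AllSig : AllSig 1 linearity
linearity-AllSig = AllSig-∀^ 3 (as-base z≤n (sig0 (qf-∧ (qf-neg (qf-rel _ _)) (qf-∧
  (qf-∨ (qf-neg (qf-rel _ _)) (qf-∨ (qf-neg (qf-rel _ _)) (qf-rel _ _)))
  (qf-∨ (qf-rel _ _) (qf-∨ (qf-eq _ _) (qf-rel _ _)))))))

triple : {X : Set} → X → X → X → Fin 3 → X
triple x y z zero             = x
triple x y z (suc zero)       = y
triple x y z (suc (suc zero)) = z

linear⇒linearity : ∀ A → IsLinearOrdering A → A ⊨ linearity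
linear⇒linearity A lin = from (Sat-∀^ A 3 orderAxioms) λ ρ → A.irrefl refl , transitive ρ , total ρ
  where
  module A = IsStrictTotalOrder lin
  transitive : ∀ (ρ : Fin 3 → Carrier A) {x y z} → ¬ _≺_ A (ρ x) (ρ y) ⊎ (¬ _≺_ A (ρ y) (ρ z) ⊎ _≺_ A (ρ x) (ρ z))
  transitive ρ {x} {y} {z} with ρ x A.<? ρ y | ρ y A.<? ρ z
  ... | no ¬p | _     = inj₁ ¬p
  ... | _     | no ¬q = inj₂ (inj₁ ¬q)
  ... | yes p | yes q = inj₂ (inj₂ (A.trans p q))

  total : ∀ (ρ : Fin 3 → Carrier A) {x y} → _≺_ A (ρ x) (ρ y) ⊎ (ρ x ≡ ρ y ⊎ _≺_ A (ρ y) (ρ x))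
  total ρ {x} {y} with A.compare (ρ x) (ρ y)
  ... | tri< p _ _ = inj₁ p
  ... | tri≈ _ e _ = inj₂ (inj₁ e)
  ... | tri> _ _ q = inj₂ (inj₂ q)

linearity⇒linear : ∀ A → A ⊨ linearity → IsLinearOrdering A
linearity⇒linear A s = isStrictTotalOrderᶜ record
  { isEquivalence = isEquivalence ; trans = transitive ; compare = tri }
  where
  at : ∀ x y z → Sat A (triple x y z) orderAxioms
  at x y z = to (Sat-∀^ A 3 orderAxioms) s (triple x y z)

  irreflexive : ∀ {x} → ¬ _≺_ A x x
  irreflexive {x} = proj₁ (at x x x)

  transitive : ∀ {x y z} → _≺_ A x y → _≺_ A y z → _≺_ A x z
  transitive {x} {y} {z} p q with proj₁ (proj₂ (at x y z))
  ... | inj₁ ¬p        = ⊥-elim (¬p p)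
  ... | inj₂ (inj₁ ¬q) = ⊥-elim (¬q q)
  ... | inj₂ (inj₂ r)  = r

  tri : ∀ x y → Tri (_≺_ A x y) (x ≡ y) (_≺_ A y x)
  tri x y with proj₂ (proj₂ (at x y x))
  ... | inj₁ p           = tri< p (λ { refl → irreflexive p }) (λ q → irreflexive (transitive p q))
  ... | inj₂ (inj₁ refl) = tri≈ irreflexive refl irreflexive
  ... | inj₂ (inj₂ q)    = tri> (λ p → irreflexive (transitive p q)) (λ { refl → irreflexive q }) q

-- Padding with `linearity` turns a finite list into a countable conjunction and puts the order
-- axioms into it. These must be there, as the sentence is tested on arbitrary structures.
conjunct : List Sentence → ℕ → Sentence
conjunct []      _       = linearity
conjunct (φ ∷ _) zero    = φ
conjunct (_ ∷ l) (suc i) = conjunct l i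

conjunct-all : {P : Sentence → Set} → P linearity → ∀ {l} → All P l → ∀ i → P (conjunct l i)
conjunct-all p []       _       = p
conjunct-all p (q ∷ _)  zero    = q
conjunct-all p (_ ∷ qs) (suc i) = conjunct-all p qs i

all-conjunct : {P : Sentence → Set} → ∀ l → (∀ i → P (conjunct l i)) → P linearity × All P l
all-conjunct []      s = s 0 , []
all-conjunct (_ ∷ l) s = let p , ps = all-conjunct l (s ∘ suc) in p , s 0 ∷ ps

suc² : ∀ {n} → Fin n → Fin (suc (suc n))
suc² i = suc (suc i)

densitySentence : ∀ {m k t} → Shape m k t → (l u p q : Tm m) → Sentence
densitySentence {m} sh l u p q = ∀^ m (⋁ λ _ → ∃' (density sh l u p q))

-- Density below, above and between the points of the gap has to be stated separately, since l
-- and u may be infinite and quantifiers range over points only.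
gapSentences : ∀ {n k t} → Shape n k t → (l u : Tm n) → List Sentence
gapSentences sh l u =
  densitySentence sh l u l u ∷
  densitySentence (rename suc sh) (wk l) (wk u) [ zero ] (wk u) ∷
  densitySentence (rename suc sh) (wk l) (wk u) (wk l) [ zero ] ∷
  densitySentence (rename suc² sh) (map± suc² l) (map± suc² u) [ zero ] [ suc zero ] ∷ []

densitySentences : ∀ {n k t j s} → Shape n k t → Shape n j s → List Sentence
densitySentences sh start                     = []
densitySentences sh (emptyG sub _ _)          = densitySentences sh sub
densitySentences sh (denseG {t = t} sub t' _) = gapSentences sh t t' ++ densitySentences sh sub

-- The constant conjunction, like the constant disjunctions nearby, only gives the formula the
-- syntactic form of its class.
configuration : ∀ {n k t} → Shape n k t → Sentence
configuration {n} sh = ∃^ n (⋀ λ _ → ∀' (guard sh))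

scottSentence : ∀ {n k t} → Shape n k t → Sentence
scottSentence sh = (⋁ λ _ → configuration sh) ∧ ⋀ (conjunct (densitySentences sh sh))

densitySentence-AllSig : ∀ {m k t} (sh : Shape m k t) l u p q → AllSig 1 (densitySentence sh l u p q)
densitySentence-AllSig {m} sh l u p q = AllSig-∀^ m (as-base (s≤s z≤n)
  (sig⋁ λ _ → ep-∃ (ep-base z≤n (pi0 (density-QF sh l u p q)))))

densitySentences-AllSig : ∀ {n k t j s} (sh : Shape n k t) (sub : Shape n j s) →
                          All (AllSig 1) (densitySentences sh sub)
densitySentences-AllSig sh start            = []
densitySentences-AllSig sh (emptyG sub _ _) = densitySentences-AllSig sh sub
densitySentences-AllSig sh (denseG {t = l} sub u _) =
  densitySentence-AllSig sh l u l u ∷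
  densitySentence-AllSig (rename suc sh) (wk l) (wk u) [ zero ] (wk u) ∷
  densitySentence-AllSig (rename suc sh) (wk l) (wk u) (wk l) [ zero ] ∷
  densitySentence-AllSig (rename suc² sh) (map± suc² l) (map± suc² u) [ zero ] [ suc zero ] ∷
  densitySentences-AllSig sh sub

scottSentence-DSig : ∀ {n k t} (sh : Shape n k t) → DSig 2 (scottSentence sh)
scottSentence-DSig {n} sh = dsig
  (sig⋁ λ _ → ExPi-∃^ n (ep-base (s≤s z≤n) (pi⋀ λ _ → as-∀ (as-base z≤n (sig0 (guard-QF sh))))))
  (pi⋀ (conjunct-all linearity-AllSig (densitySentences-AllSig sh sh)))

module Realised (A : Structure) (lin : IsLinearOrdering A) {n k : ℕ} (sh : Shape n k ⊤±) where
  open Ends A lin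
  open Semantics A lin
  open Truth A lin

  densitySentence-⇔ : ∀ {m j t} (sh : Shape m j t) l u p q →
    A ⊨ densitySentence sh l u p q ⇔ (∀ ρ → ∃[ z ] Density ρ z sh l u p q)
  densitySentence-⇔ {m} sh l u p q = mk⇔
    (λ s ρ → let _ , z , d = to (Sat-∀^ A m ψ) s ρ in z , to (density-⇔ ρ z sh l u p q) d)
    (λ s → from (Sat-∀^ A m ψ) λ ρ → let z , d = s ρ in 0 , z , from (density-⇔ ρ z sh l u p q) d)
    where
    ψ = ⋁ λ _ → ∃' (density sh l u p q)

  densitySentences-hold : ∀ {ρ : Fin n → Carrier A} → Known ⊥ k ⊤± → Ordered ρ sh → DenseGaps ρ sh →
    ∀ {j t} (sub : Shape n j t) → (∀ {l u} → DenseGap sub l u → DenseGap sh l u) →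
    All (A ⊨_) (densitySentences sh sub)
  densitySentences-hold K o d start            _     = []
  densitySentences-hold K o d (emptyG sub _ _) embed = densitySentences-hold K o d sub (embed ∘ underE)
  densitySentences-hold {ρ} K o d (denseG {t = l} sub u _) embed =
    holds sh gap l u ∷
    holds (rename suc sh) (rename-gap suc gap) [ zero ] (wk u) ∷
    holds (rename suc sh) (rename-gap suc gap) (wk l) [ zero ] ∷
    holds (rename suc² sh) (rename-gap suc² gap) [ zero ] [ suc zero ] ∷
    densitySentences-hold K o d sub (embed ∘ underD)
    where
    gap = embed here
    -- A dense gap is inhabited. Its point serves as the witness for tuples at which the density
    -- claim holds vacuously.
    z₀ = proj₁ (point (proj₂ (gap-filled ρ gap o d)))

    holds : ∀ {m} (sh' : Shape m k ⊤±) {l u} → DenseGap sh' l u → ∀ p q → A ⊨ densitySentence sh' l u p q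
    holds sh' {l} {u} d p q = from (densitySentence-⇔ sh' l u p q) λ ρ → density-holds ρ K d z₀ p q

  scottSentence-holds : ∀ {ρ : Fin n → Carrier A} → Known ⊥ k ⊤± →
    Ordered ρ sh → EmptyGaps ρ sh → DenseGaps ρ sh → A ⊨ scottSentence sh
  scottSentence-holds {ρ} K o g d =
    (0 , from (Sat-∃^ A n (⋀ λ _ → ∀' (guard sh))) (ρ , λ _ z → from (guard-⇔ ρ z sh) (EmptyGaps⇒Guard ρ sh o g z))) ,
    conjunct-all (linear⇒linearity A lin) (densitySentences-hold K o d sh id)

  Guard-rename : ∀ {m} (f : Fin n → Fin m) {ρ : Fin n → Carrier A} {ρ'} →
    (∀ t → eval ρ' (map± f t) ≡ eval ρ t) → ∀ {z j t} (sub : Shape n j t) →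
    Guard ρ z sub → Guard ρ' z (rename f sub)
  Guard-rename f agree start _ = tt
  Guard-rename f agree (emptyG {t = t} sub t' _) (g , p) rewrite agree t | agree t' = Guard-rename f agree sub g , p
  Guard-rename f agree (denseG {t = t} sub t' _) (g , p) rewrite agree t | agree t' = Guard-rename f agree sub g , p

  module _ (ρ : Fin n → Carrier A) (guards : ∀ z → Guard ρ z sh) where

    between : ∀ {m j t} (sh' : Shape m j t) (ρ' : Fin m → Carrier A) → (∀ z → Guard ρ' z sh') →
      ∀ l u p q → A ⊨ densitySentence sh' l u p q →
      eval ρ' l ≤ eval ρ' p → eval ρ' p <± eval ρ' q → eval ρ' q ≤ eval ρ' u → ∃ (Between (eval ρ' p) (eval ρ' q))
    between sh' ρ' g l u p q s l≤p p<q q≤u with to (densitySentence-⇔ sh' _ _ _ _) s ρ'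
    ... | z , inj₁ ¬g        = ⊥-elim (¬g (g z))
    ... | z , inj₂ (inj₁ ¬c) = ⊥-elim (¬c ((λ p<l → <⇒≱ p<l l≤p) , p<q , λ u<q → <⇒≱ u<q q≤u))
    ... | z , inj₂ (inj₂ b)  = [ z ] , b

    gap-filled-by : ∀ l u → All (A ⊨_) (gapSentences sh l u) → Filled ρ l u
    gap-filled-by l u (s₀ ∷ s₁ ∷ s₂ ∷ s₃ ∷ []) x y (inj₂ refl) x<y (inj₂ refl) =
      between sh ρ guards l u l u s₀ ≤-refl x<y ≤-refl
    gap-filled-by l u (s₀ ∷ s₁ ∷ s₂ ∷ s₃ ∷ []) x y (inj₁ l<x) x<y (inj₂ refl) with point (l<x , x<y)
    ... | a , refl = subst (λ e → ∃ (Between [ a ] e)) (agree u) (between (rename suc sh) ρ⁺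
        (λ z → Guard-rename suc agree sh (guards z)) (wk l) (wk u) [ zero ] (wk u) s₁
        (inj₁ (subst (_<± [ a ]) (sym (agree l)) l<x)) (subst ([ a ] <±_) (sym (agree u)) x<y) ≤-refl)
      where
      ρ⁺ = extend a ρ
      agree = map±-∘ ρ⁺ suc
    gap-filled-by l u (s₀ ∷ s₁ ∷ s₂ ∷ s₃ ∷ []) x y (inj₂ refl) x<y (inj₁ y<u) with point (x<y , y<u)
    ... | b , refl = subst (λ e → ∃ (Between e [ b ])) (agree l) (between (rename suc sh) ρ⁺
        (λ z → Guard-rename suc agree sh (guards z)) (wk l) (wk u) (wk l) [ zero ] s₂
        ≤-refl (subst (_<± [ b ]) (sym (agree l)) x<y) (inj₁ (subst ([ b ] <±_) (sym (agree u)) y<u)))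
      where
      ρ⁺ = extend b ρ
      agree = map±-∘ ρ⁺ suc
    gap-filled-by l u (s₀ ∷ s₁ ∷ s₂ ∷ s₃ ∷ []) x y (inj₁ l<x) x<y (inj₁ y<u)
      with point (l<x , x<y) | point (x<y , y<u)
    ... | a , refl | b , refl = between (rename suc² sh) ρ⁺
        (λ z → Guard-rename suc² agree sh (guards z))
        (map± suc² l) (map± suc² u) [ zero ] [ suc zero ] s₃
        (inj₁ (subst (_<± [ a ]) (sym (agree l)) l<x)) x<y (inj₁ (subst ([ b ] <±_) (sym (agree u)) y<u))
      where
      ρ⁺ = extend a (extend b ρ)
      agree = map±-∘ ρ⁺ suc²

    dense-gaps : ∀ {j t} (sub : Shape n j t) → All (A ⊨_) (densitySentences sh sub) → DenseGaps ρ sub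
    dense-gaps start                     _  = tt
    dense-gaps (emptyG sub _ _)          ss = dense-gaps sub ss
    dense-gaps (denseG {t = t} sub t' _) ss =
      let here-ss , rest = ++⁻ (gapSentences sh t t') ss in
      dense-gaps sub rest , gap-filled-by t t' here-ss

-- The contradiction

mainTheorem2 : ¬ (Σ[ A ∈ Structure ] (IsLinearOrdering A × SSC-is-Σ3 A))
mainTheorem2 (A₀ , lin₀ , (φ@(⋁ f) , sig⋁ p , scott) , _ , minimal) = finish
  where
  i₀ : ℕ
  i₀ = proj₁ (from (scott A₀) ≅-refl)

  finish : ⊥
  finish with matrix (p i₀)
  ... | n , ψ , (b , b≤2 , pi) , down , up with conjuncts b≤2 pi
  ... | θ , univ , θ-⇔ = Resolve.resolved univ categorical base noScott
    where
    -- A model of `θ` satisfies the chosen disjunct, hence the given Scott sentence. This is the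
    -- source of categoricity.
    toA₀ : (M : Model θ) → Model.str M ≅ A₀
    toA₀ M = to (scott str) (i₀ , Sat-resp str (f i₀) (λ ()) (proj₂ (up str param (from (θ-⇔ str param) sat))))
      where open Model M

    categorical : (M N : Model θ) → Model.str M ≅ Model.str N
    categorical M N = ≅-trans (toA₀ M) (≅-sym (toA₀ N))

    base : Model θ
    base = let a , s = down A₀ emptyEnv (proj₂ (from (scott A₀) ≅-refl)) in
      record { str = A₀ ; linear = lin₀ ; param = a ; sat = to (θ-⇔ A₀ a) s }

    noScott : ¬ Resolve.Resolved univ categorical
    noScott (M , k , K , params∈) = refute (Named.last named) shape ordered gapless filled covers
      where
      open Model M
      open Ends str linear
      open Semantics str linear
      named = name K
      open Named named using (size; t; shape; ordered; gapless; filled; covers)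
      ρ = Named.ρ named

      -- The last term is generalised so that matching can exclude all terms but `⊤±`.
      refute : ∀ {t} → eval ρ t ≡ ⊤± → (sh : Shape size k t) →
               Ordered ρ sh → EmptyGaps ρ sh → DenseGaps ρ sh →
               (∀ {e} → Mem e K → ∃[ t' ] (t' ∈ ends sh × eval ρ t' ≡ e)) → ⊥
      refute {⊥±}    ()
      refute {[ _ ]} ()
      refute {⊤±} refl sh o g d cov = proj₂ (proj₂ (minimal 2 (s≤s z≤n) (s≤s (s≤s z≤n))))
        (scottSentence sh , scottSentence-DSig sh , λ B → mk⇔ (sound B) (complete B))
        where
        index : ∀ {x} → (∃[ t' ] (t' ∈ ends sh × eval ρ t' ≡ [ x ])) → ∃[ i ] ([ i ] ∈ ends sh × ρ i ≡ x)
        index ([ i ] , i∈ , refl) = i , i∈ , refl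

        ix : ∀ j → ∃[ i ] ([ i ] ∈ ends sh × ρ i ≡ param j)
        ix j = index (cov (params∈ j))

        complete : ∀ B → B ≅ A₀ → B ⊨ scottSentence sh
        complete B h = from (Sat-≅ (≅-trans h (≅-sym (toA₀ M))) (scottSentence sh) λ ())
          (Realised.scottSentence-holds str linear sh K o g d)

        -- A structure satisfying the sentence realises the shape and therefore satisfies `θ`, with
        -- those endpoints as parameters that correspond to the parameters of `M`.
        sound : ∀ B → B ⊨ scottSentence sh → B ≅ A₀
        sound B ((_ , conf) , axioms) = toA₀ (record
          { str = B ; linear = linB ; param = ρ' ∘ proj₁ ∘ ix
          ; sat = realisation-reflects linear linB sh o g d
              (TB.guarded-ordered ρ' sh guards) (TB.guarded-empty ρ' sh guards)
              (Realised.dense-gaps B linB sh ρ' guards sh (proj₂ all-axioms))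
              (proj₁ ∘ ix) (λ j → proj₁ (proj₂ (ix j))) univ
              (λ i → Sat-resp str (θ i) (λ j → sym (proj₂ (proj₂ (ix j)))) (sat i)) })
          where
          all-axioms = all-conjunct (densitySentences sh sh) axioms
          linB = linearity⇒linear B (proj₁ all-axioms)
          module TB = Truth B linB
          config = to (Sat-∃^ B size (⋀ λ _ → ∀' (guard sh))) conf
          ρ' = proj₁ config
          guards : ∀ z → TB.Guard ρ' z sh
          guards z = to (TB.guard-⇔ ρ' z sh) (proj₂ config 0 z)
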